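{- Let $a,b\in\mathbb{Z}$ be such that $\dfrac{256b^3-27a^4}{\gcd(256b^3,27a^4)}$ is square-free. Suppose $f_{a,b}(x)=x^4+ax+b$ is irreducible over $\mathbb{Q}$ and let $\theta$ be a root. Suppose further that every prime $p$ dividing $\gcd(256b^3,27a^4)$ satisfies one of the following: (1) $p\mid a$ and $p\mid b$, but $p^2\nmid b$; (2) $p=2$, $2\nmid b$, and $(a \bmod 4, b\bmod 4)$ is one of $(0,1)$, $(2,3)$; (3) $p=3$, $3\nmid a$, and $(a\bmod 9,b\bmod 9)$ is one of $(1,3)$, $(1,6)$, $(2,0)$, $(2,3)$, $(4,0)$, $(4,6)$, $(5,0)$, $(5,6)$, $(7,0)$, $(7,3)$, $(8,3)$, $(8,6)$. Then $\mathbb{Q}(\theta)$ is monogenic and $\mathbb{Z}[\theta]$ is the ring of integers of $\mathbb{Q}(\theta)$.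
   Context: A number field $K$ is monogenic if its ring of integers $\mathcal{O}_K$ equals $\mathbb{Z}[\alpha]$ for some $\alpha\in\mathcal{O}_K$. -}

module Defs where

open import Data.Nat as ℕ using (ℕ; _≤_)
open import Data.Nat.Divisibility as ℕD using ()
open import Data.Nat.GCD using (gcd)
open import Data.Nat.Primality using (Prime)
open import Data.Integer as ℤ using (ℤ; +_; ∣_∣; _%ℕ_)
open import Data.Integer.Divisibility as ℤD using ()
open import Data.Rational as ℚ using (ℚ; 0ℚ; 1ℚ)
open import Data.List using (List; []; _∷_; map; _++_; [_]; length)
open import Data.List.Membership.Propositional using (_∈_)
open import Data.Product using (Σ; _×_; _,_; ∃)
open import Data.Sum using (_⊎_)
open import Relation.Nullary using (¬_)
open import Relation.Binary.PropositionalEquality using (_≡_; _≢_)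
open import Function.Bundles using (_⇔_)

ι : ℤ → ℚ
ι z = z ℚ./ 1

-- Polynomials over ℚ as coefficient lists (constant term first)

Poly : Set
Poly = List ℚ

_+ₚ_ : Poly → Poly → Poly
[]       +ₚ q        = q
(c ∷ p)  +ₚ []       = c ∷ p
(c ∷ p)  +ₚ (d ∷ q)  = (c ℚ.+ d) ∷ (p +ₚ q)

_*ₚ_ : Poly → Poly → Poly
[]      *ₚ q = []
(c ∷ p) *ₚ q = map (c ℚ.*_) q +ₚ (0ℚ ∷ (p *ₚ q))

fPoly : ℤ → ℤ → Poly
fPoly a b = ι b ∷ ι a ∷ 0ℚ ∷ 0ℚ ∷ 1ℚ ∷ []

-- A polynomial of degree ≥ 1 with nonzero leading coefficient is written
-- as  p₀ ++ [ l ]  with  length p₀ ≥ 1  and  l ≢ 0.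
-- f is reducible over ℚ if it is a product of two polynomials of positive degree.
Reducibleℚ : Poly → Set
Reducibleℚ f = Σ Poly λ g₀ → Σ ℚ λ l₁ → Σ Poly λ h₀ → Σ ℚ λ l₂ →
  (l₁ ≢ 0ℚ) × (l₂ ≢ 0ℚ) × (1 ≤ length g₀) × (1 ≤ length h₀) ×
  ((g₀ ++ [ l₁ ]) *ₚ (h₀ ++ [ l₂ ]) ≡ f)

Irreducibleℚ : Poly → Set
Irreducibleℚ f = ¬ Reducibleℚ f

-- The number field K = ℚ(θ) ≅ ℚ[x]/(x^4 + a x + b), elements written
-- in the ℚ-basis 1, θ, θ², θ³.

record K : Set where
  constructor ⟨_,_,_,_⟩
  field
    c₀ c₁ c₂ c₃ : ℚ
open K public

module Field (a b : ℤ) where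

  0K : K
  0K = ⟨ 0ℚ , 0ℚ , 0ℚ , 0ℚ ⟩

  θ : K
  θ = ⟨ 0ℚ , 1ℚ , 0ℚ , 0ℚ ⟩

  _+K_ : K → K → K
  x +K y = ⟨ c₀ x ℚ.+ c₀ y , c₁ x ℚ.+ c₁ y , c₂ x ℚ.+ c₂ y , c₃ x ℚ.+ c₃ y ⟩

  scale : ℚ → K → K
  scale r x = ⟨ r ℚ.* c₀ x , r ℚ.* c₁ x , r ℚ.* c₂ x , r ℚ.* c₃ x ⟩

  -- multiplication by θ, using θ⁴ = - a θ - b
  mulθ : K → K
  mulθ x = ⟨ ℚ.- (ι b ℚ.* c₃ x) , c₀ x ℚ.- (ι a ℚ.* c₃ x) , c₁ x , c₂ x ⟩

  _*K_ : K → K → K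
  x *K y = scale (c₀ x) y +K (scale (c₁ x) (mulθ y) +K
           (scale (c₂ x) (mulθ (mulθ y)) +K scale (c₃ x) (mulθ (mulθ (mulθ y)))))

  1K : K
  1K = ⟨ 1ℚ , 0ℚ , 0ℚ , 0ℚ ⟩

  evalK : Poly → K → K
  evalK []       x = 0K
  evalK (c ∷ p)  x = scale c 1K +K (x *K evalK p x)

  IsIntegral : K → Set
  IsIntegral x = Σ (List ℤ) λ cs → evalK (map ι cs ++ [ 1ℚ ]) x ≡ 0K

  InZAdj : K → K → Set
  InZAdj α x = Σ (List ℤ) λ cs → evalK (map ι cs) α ≡ x

  RingOfIntegersIs : K → Set
  RingOfIntegersIs α = ∀ x → IsIntegral x ⇔ InZAdj α x

  Monogenic : Set
  Monogenic = Σ K λ α → RingOfIntegersIs α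

SquareFreeℕ : ℕ → Set
SquareFreeℕ n = ∀ d → (d ℕ.* d) ℕD.∣ n → d ≡ 1

gAB : ℤ → ℤ → ℕ
gAB a b = gcd ∣ + 256 ℤ.* (b ℤ.* b ℤ.* b) ∣ ∣ + 27 ℤ.* (a ℤ.* a ℤ.* a ℤ.* a) ∣

ΔAB : ℤ → ℤ → ℤ
ΔAB a b = + 256 ℤ.* (b ℤ.* b ℤ.* b) ℤ.- + 27 ℤ.* (a ℤ.* a ℤ.* a ℤ.* a)

QuotSquareFree : ℤ → ℤ → Set
QuotSquareFree a b = Σ ℤ λ q → (ΔAB a b ≡ q ℤ.* (+ gAB a b)) × SquareFreeℕ ∣ q ∣

Cond1 : ℕ → ℤ → ℤ → Set
Cond1 p a b = ((+ p) ℤD.∣ a) × ((+ p) ℤD.∣ b) × ¬ ((+ (p ℕ.* p)) ℤD.∣ b)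

Cond2 : ℕ → ℤ → ℤ → Set
Cond2 p a b = (p ≡ 2) × ¬ ((+ 2) ℤD.∣ b) ×
  (((a %ℕ 4 , b %ℕ 4) ≡ (0 , 1)) ⊎ ((a %ℕ 4 , b %ℕ 4) ≡ (2 , 3)))

pairs9 : List (ℕ × ℕ)
pairs9 = (1 , 3) ∷ (1 , 6) ∷ (2 , 0) ∷ (2 , 3) ∷ (4 , 0) ∷ (4 , 6) ∷
         (5 , 0) ∷ (5 , 6) ∷ (7 , 0) ∷ (7 , 3) ∷ (8 , 3) ∷ (8 , 6) ∷ []

Cond3 : ℕ → ℤ → ℤ → Set
Cond3 p a b = (p ≡ 3) × ¬ ((+ 3) ℤD.∣ a) × ((a %ℕ 9 , b %ℕ 9) ∈ pairs9)

PrimeConds : ℤ → ℤ → Set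
PrimeConds a b = ∀ p → Prime p → p ℕD.∣ gAB a b → Cond1 p a b ⊎ Cond2 p a b ⊎ Cond3 p a b

{-# OPTIONS --safe #-}
-- Let A = ℤ[θ]. If x is integral over ℤ, then N xᵏ ∈ A for all k, where N is a power of a denominator
-- of x. It is enough to remove the prime factors p of N one at a time: if p ∣ N and N xᵏ ∈ A for all k,
-- then N xᵏ ∈ pA for all k. What can be used is that w = N xᵏ satisfies w² = N (N x^(2k)) ∈ pA.
--
-- If p ∤ gcd(256b³, 27a⁴), then p² ∤ Δ = 256b³ − 27a⁴. By Cayley–Hamilton and Newton's identities an
-- element whose square lies in pA has trace divisible by p. Hence p ∣ Tr(wθⁱ) and p² ∣ N Tr(N x^(2k)) = Tr(w²).
-- Since Δ w₃² + 36a² Tr(w²) is a quadratic form in Tr(w), Tr(wθ), Tr(wθ²), where w₃ is the coefficient of θ³,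
-- p² ∣ Δ w₃² and so p ∣ w₃. The other coefficients then follow from p ∣ Tr(wθⁱ).
--
-- If p divides the gcd, then pA has radical (p , h), where h = θ − c if f(x + c) is Eisenstein at p (c is 0 or 1),
-- and h = θ (θ + a) if p = 3 and f ≡ x (x + a)³. By the Pohst–Zassenhaus argument hʲ⁺¹ w ∈ pA for all k
-- implies hʲ w ∈ pA for all k; this starts with h⁴ ∈ pA.
module Submission where

open import Defs
open import Algebra using (CommutativeRing)
open import Data.List using (List; []; _∷_; map; length; _++_; [_])
open import Data.Nat as ℕ using (ℕ; zero; suc; s≤s; z≤n)
import Data.Nat.Properties as ℕₚ
open import Data.Nat.Induction using (<-rec)
open import Data.Product using (∃; _,_; _×_; proj₁; proj₂)
open import Relation.Nullary using (¬_; Dec; yes; no; contradiction; ¬?; _×-dec_)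
open import Relation.Nullary.Decidable using (from-yes; from-no)
open import Relation.Binary.PropositionalEquality as ≡ using (_≡_)

-- Square sequences and maximality in a commutative ring.

module CommutativeRingLemmas {c ℓ} (R : CommutativeRing c ℓ) where
  open CommutativeRing R
  open import Algebra.Properties.CommutativeSemigroup.Divisibility *-commutativeSemigroup
  open import Algebra.Properties.Semiring.Exp semiring
  open import Algebra.Properties.Ring ring using (-‿distribˡ-*)
  open import Relation.Binary.Reasoning.Setoid setoid
  open import Algebra.Solver.Ring.NaturalCoefficients.Default commutativeSemiring
    using (solve; _:+_; _:*_; _:=_)

  Regular : Carrier → Set _
  Regular p = ∀ {x y} → x * p ≈ y * p → x ≈ y

  ^-regular : ∀ {n} → Regular n → ∀ k → Regular (n ^ k)
  ^-regular reg zero    {x} {y} eq = trans (sym (*-identityʳ x)) (trans eq (*-identityʳ y))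
  ^-regular {n} reg (suc k) {x} {y} eq =
    reg (^-regular reg k (trans (*-assoc x n _) (trans eq (sym (*-assoc y n _)))))

  ∣-+-cancelˡ : ∀ {d x y} → d ∣ x → d ∣ x + y → d ∣ y
  ∣-+-cancelˡ {d} {x} {y} (q , qd≈x) (r , rd≈x+y) = - q + r , (begin
    (- q + r) * d       ≈⟨ distribʳ d (- q) r ⟩
    - q * d + r * d     ≈⟨ +-cong (trans (sym (-‿distribˡ-* q d)) (-‿cong qd≈x)) rd≈x+y ⟩
    - x + (x + y)       ≈⟨ sym (+-assoc (- x) x y) ⟩
    (- x + x) + y       ≈⟨ +-congʳ (-‿inverseˡ x) ⟩
    0# + y              ≈⟨ +-identityˡ y ⟩
    y                   ∎)

  ∣-*ʳ : ∀ {d x} y → d ∣ x → d ∣ x * y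
  ∣-*ʳ {x = x} y d∣x = ∣-respʳ (*-comm y x) (x∣ʳy⇒x∣ʳzy y d∣x)

  -- n ^ length cs times the value at y / n of the monic polynomial with lower coefficients cs.
  homogenise : Carrier → Carrier → List Carrier → Carrier
  homogenise n y []       = 1#
  homogenise n y (c ∷ cs) = c * n ^ suc (length cs) + y * homogenise n y cs

  module _ {n y : Carrier} where

    private
      _DividesAt_ : Carrier → ℕ → Set _
      N DividesAt k = n ^ k ∣ N * y ^ k

    -- Multiplied by N yᵏ, the term of `homogenise` containing yⁱ is cᵢ n^(d - i) (N y^(k + i)),
    -- where d is the length of `cs`. For i < d it is divisible by n^(k + d), so the leading term N
    -- y^(k + d) is too. The induction splits off the constant term and moves one factor y into yᵏ.
    leading : ∀ N cs k → (∀ i → i ℕ.< length cs → N DividesAt (k ℕ.+ i)) →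
      n ^ (k ℕ.+ length cs) ∣ (N * y ^ k) * homogenise n y cs →
      N DividesAt (k ℕ.+ length cs)
    leading N [] k _ hyp rewrite ℕₚ.+-identityʳ k = ∣-respʳ (*-identityʳ _) hyp
    leading N (c ∷ cs) k low hyp =
      ≡.subst (N DividesAt_) (≡.sym (ℕₚ.+-suc k l))
        (leading N cs (suc k) low′ (≡.subst (λ j → n ^ j ∣ (N * y ^ suc k) * H) (ℕₚ.+-suc k l) (∣-+-cancelˡ first hyp′)))
      where
      l = length cs
      H = homogenise n y cs
      low′ : ∀ i → i ℕ.< l → N DividesAt (suc k ℕ.+ i)
      low′ i i<l = ≡.subst (N DividesAt_) (ℕₚ.+-suc k i) (low (suc i) (s≤s i<l))
      first : n ^ (k ℕ.+ suc l) ∣ c * ((N * y ^ k) * n ^ suc l)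
      first = x∣ʳy⇒x∣ʳzy c (∣-respˡ (sym (^-homo-* n k (suc l)))
        (x∣ʳy⇒xz∣ʳyz _ (≡.subst (N DividesAt_) (ℕₚ.+-identityʳ k) (low 0 (s≤s z≤n)))))
      hyp′ : n ^ (k ℕ.+ suc l) ∣ c * ((N * y ^ k) * n ^ suc l) + (N * y ^ suc k) * H
      hyp′ = ∣-respʳ (solve 6 (λ N yᵏ c nˡ y H → ((N :* yᵏ) :* (c :* nˡ :+ y :* H)) :=
        (c :* ((N :* yᵏ) :* nˡ) :+ (N :* (y :* yᵏ)) :* H)) refl N (y ^ k) c (n ^ suc l) y H) hyp

    -- With x = y / n and d the degree, this says that n^d xᵏ lies in R for every k. Up to k = d the
    -- factor n^d clears the denominator; beyond that the monic equation reduces xᵏ to the d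
    -- preceding powers.
    powers-almost-divisible : ∀ cs → homogenise n y cs ≈ 0# →
      ∀ k → n ^ k ∣ n ^ length cs * y ^ k
    powers-almost-divisible cs root = <-rec _ go
      where
      d = length cs
      go : ∀ k → (∀ {j} → j ℕ.< k → (n ^ d) DividesAt j) → (n ^ d) DividesAt k
      go k rec with k ℕ.≤? d
      ... | yes k≤d = y ^ k * n ^ (d ℕ.∸ k) , (begin
        (y ^ k * n ^ (d ℕ.∸ k)) * n ^ k   ≈⟨ *-assoc _ _ _ ⟩
        y ^ k * (n ^ (d ℕ.∸ k) * n ^ k)   ≈⟨ *-congˡ (sym (^-homo-* n (d ℕ.∸ k) k)) ⟩
        y ^ k * n ^ (d ℕ.∸ k ℕ.+ k)       ≈⟨ *-congˡ (^-congʳ n (ℕₚ.m∸n+n≡m k≤d)) ⟩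
        y ^ k * n ^ d                     ≈⟨ *-comm _ _ ⟩
        n ^ d * y ^ k                     ∎)
      ... | no k≰d = ≡.subst ((n ^ d) DividesAt_) k′+d≡k
        (leading (n ^ d) cs k′
          (λ i i<d → rec (≡.subst (k′ ℕ.+ i ℕ.<_) k′+d≡k (ℕₚ.+-monoʳ-< k′ i<d)))
          -- The homogenised value is zero, so the divisibility required by `leading` holds with
          -- quotient 0.
          (0# , trans (zeroˡ _) (sym (trans (*-congˡ root) (zeroʳ _)))))
        where
        k′ = k ℕ.∸ d
        k′+d≡k : k′ ℕ.+ d ≡ k
        k′+d≡k = ℕₚ.m∸n+n≡m (ℕₚ.<⇒≤ (ℕₚ.≰⇒> k≰d))

  -- Satisfied by v k = N xᵏ, where x lies in an extension of R. Thus MaximalAt p says that if all N p xᵏ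
  -- lie in R, then so do all N xᵏ.
  SquareSequence : Carrier → (ℕ → Carrier) → Set _
  SquareSequence N v = ∀ k → v k * v k ≈ N * v (k ℕ.+ k)

  MaximalAt : Carrier → Set _
  MaximalAt p = ∀ N v → SquareSequence (N * p) v → ∀ k → p ∣ v k

  -- The sequence is v k = N xᵏ with x = y / n and N = n^d. The relation (N xᵏ)² = N (N x^(2k))
  -- holds after multiplication by n^(2k), which is then cancelled. The last component records that
  -- v 1 is N x without mentioning x.
  almost-integral-sequence : ∀ {n y} → Regular n → ∀ cs → homogenise n y cs ≈ 0# →
    ∃ λ v → SquareSequence (n ^ length cs) v × (v 1 * n ≈ n ^ length cs * y)
  almost-integral-sequence {n} {y} reg cs root = v , square ,
    trans (*-congˡ (sym (*-identityʳ n))) (trans (v-eq 1) (*-congˡ (*-identityʳ y)))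
    where
    N = n ^ length cs
    v : ℕ → Carrier
    v k = _∣ʳ_.quotient (powers-almost-divisible cs root k)
    v-eq : ∀ k → v k * n ^ k ≈ N * y ^ k
    v-eq k = _∣ʳ_.equality (powers-almost-divisible cs root k)
    square : SquareSequence N v
    square k = ^-regular reg (k ℕ.+ k) (begin
      (v k * v k) * n ^ (k ℕ.+ k)       ≈⟨ *-congˡ (^-homo-* n k k) ⟩
      (v k * v k) * (n ^ k * n ^ k)     ≈⟨ solve 2 (λ a b → (a :* a) :* (b :* b) := (a :* b) :* (a :* b)) refl (v k) (n ^ k) ⟩
      (v k * n ^ k) * (v k * n ^ k)     ≈⟨ *-cong (v-eq k) (v-eq k) ⟩
      (N * y ^ k) * (N * y ^ k)         ≈⟨ solve 2 (λ a b → (a :* b) :* (a :* b) := a :* (a :* (b :* b))) refl N (y ^ k) ⟩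
      N * (N * (y ^ k * y ^ k))         ≈⟨ *-congˡ (*-congˡ (sym (^-homo-* y k k))) ⟩
      N * (N * y ^ (k ℕ.+ k))           ≈⟨ *-congˡ (sym (v-eq (k ℕ.+ k))) ⟩
      N * (v (k ℕ.+ k) * n ^ (k ℕ.+ k)) ≈⟨ sym (*-assoc _ _ _) ⟩
      (N * v (k ℕ.+ k)) * n ^ (k ℕ.+ k) ∎)

  -- From N p xᵏ to N xᵏ. The square relation is quadratic in v, so p is cancelled twice; the
  -- relation for v 1 needs one cancellation.
  divide-sequence : ∀ {p} → Regular p → MaximalAt p →
    ∀ {N v n y} → SquareSequence (N * p) v → v 1 * n ≈ (N * p) * y →
    ∃ λ v′ → SquareSequence N v′ × (v′ 1 * n ≈ N * y)
  divide-sequence {p} reg max {N} {v} {n} {y} square v₁ = v′ ,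
    (λ k → reg (reg (begin
      ((v′ k * v′ k) * p) * p    ≈⟨ solve 2 (λ a b → ((a :* a) :* b) :* b := (a :* b) :* (a :* b)) refl (v′ k) p ⟩
      (v′ k * p) * (v′ k * p)    ≈⟨ *-cong (v′-eq k) (v′-eq k) ⟩
      v k * v k                  ≈⟨ square k ⟩
      (N * p) * v (k ℕ.+ k)      ≈⟨ *-congˡ (sym (v′-eq (k ℕ.+ k))) ⟩
      (N * p) * (v′ (k ℕ.+ k) * p) ≈⟨ solve 3 (λ N p u → (N :* p) :* (u :* p) := ((N :* u) :* p) :* p) refl N p (v′ (k ℕ.+ k)) ⟩
      ((N * v′ (k ℕ.+ k)) * p) * p ∎))) ,
    reg (begin
      (v′ 1 * n) * p   ≈⟨ solve 3 (λ a b c → (a :* b) :* c := (a :* c) :* b) refl (v′ 1) n p ⟩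
      (v′ 1 * p) * n   ≈⟨ *-congʳ (v′-eq 1) ⟩
      v 1 * n          ≈⟨ v₁ ⟩
      (N * p) * y      ≈⟨ solve 3 (λ a b c → (a :* b) :* c := (a :* c) :* b) refl N p y ⟩
      (N * y) * p      ∎)
    where
    v′ : ℕ → Carrier
    v′ k = _∣ʳ_.quotient (max N v square k)
    v′-eq : ∀ k → v′ k * p ≈ v k
    v′-eq k = _∣ʳ_.equality (max N v square k)

  -- The Pohst–Zassenhaus criterion: I is the radical (p , h), and w / p is a multiplier of I
  -- when w and (h * w) / p lie in I.
  maximal-from-radical : ∀ {p h} → Regular p → ∀ {i} (I : Carrier → Set i) →
    (∀ {w} → p ∣ w → I w) → (∀ {w} → I (w * w) → I w) →
    p ∣ h * (h * (h * h)) → (∀ {w t} → I w → t * p ≈ h * w → I t → p ∣ w) →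
    MaximalAt p
  maximal-from-radical {p} {h} reg I p∣⇒I I-sqrt (s , s-eq) multiplier N v square =
    -- Each `step` strips one factor h, from h⁴ down to `1#`.
    λ k → ∣-respʳ (*-identityˡ (v k)) (step 1# (step _ (step _ (step _ initial))) k)
    where
    initial : ∀ k → p ∣ (h * (h * (h * (h * 1#)))) * v k
    initial k = ∣-*ʳ (v k) (∣-respʳ (*-congˡ (*-congˡ (*-congˡ (sym (*-identityʳ h))))) (s , s-eq))
    module _ (g : Carrier) (hyp : ∀ k → p ∣ (h * g) * v k) (k : ℕ) where
      w = g * v k
      w∈I : I w
      w∈I = I-sqrt (p∣⇒I ((g * g) * (N * v (k ℕ.+ k)) , (begin
        ((g * g) * (N * v (k ℕ.+ k))) * p  ≈⟨ solve 4 (λ g N u p → ((g :* g) :* (N :* u)) :* p := (g :* g) :* ((N :* p) :* u)) refl g N (v (k ℕ.+ k)) p ⟩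
        (g * g) * ((N * p) * v (k ℕ.+ k))  ≈⟨ *-congˡ (sym (square k)) ⟩
        (g * g) * (v k * v k)              ≈⟨ solve 2 (λ g u → (g :* g) :* (u :* u) := (g :* u) :* (g :* u)) refl g (v k) ⟩
        w * w ∎)))
      -- Squaring gives p² on the left, and v j * v j contributes one p on the right. A single p
      -- survives the cancellation, so the shape is preserved with the index doubled and the lemma
      -- can be iterated.
      square-root : ∀ {x y j} → x * p ≈ y * v j → x * x * p ≈ (y * y * N) * v (j ℕ.+ j)
      square-root {x} {y} {j} eq = reg (begin
        (x * x * p) * p          ≈⟨ solve 2 (λ x p → (x :* x :* p) :* p := (x :* p) :* (x :* p)) refl x p ⟩
        (x * p) * (x * p)        ≈⟨ *-cong eq eq ⟩
        (y * v j) * (y * v j)    ≈⟨ solve 2 (λ y u → (y :* u) :* (y :* u) := (y :* y) :* (u :* u)) refl y (v j) ⟩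
        (y * y) * (v j * v j)    ≈⟨ *-congˡ (square j) ⟩
        (y * y) * ((N * p) * v (j ℕ.+ j)) ≈⟨ solve 4 (λ y N p u → (y :* y) :* ((N :* p) :* u) := ((y :* y :* N) :* u) :* p) refl y N p (v (j ℕ.+ j)) ⟩
        ((y * y * N) * v (j ℕ.+ j)) * p ∎)
      step : p ∣ w
      step with hyp k
      -- To see that t lies in I: two squarings of t p = h g v k give t⁴ p = h⁴ G v (4k). Since h⁴ =
      -- s p, this leaves t⁴ = s G v (4k), and the square relation at 4k puts a factor p into t⁸.
      -- Three square roots then return from t⁸ to t.
      ... | t , t-eq = multiplier w∈I (trans t-eq (*-assoc h g (v k))) (I-sqrt (I-sqrt (I-sqrt (p∣⇒I t⁸))))
        where
        k₄ = (k ℕ.+ k) ℕ.+ (k ℕ.+ k)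
        G = g * g * (g * g) * (N * N) * N
        t⁴ : (t * t) * (t * t) ≈ (s * G) * v k₄
        t⁴ = reg (begin
          (t * t) * (t * t) * p ≈⟨ square-root (square-root t-eq) ⟩
          ((h * g) * (h * g) * N) * ((h * g) * (h * g) * N) * N * v k₄
            ≈⟨ solve 4 (λ h g N u → ((h :* g) :* (h :* g) :* N) :* ((h :* g) :* (h :* g) :* N) :* N :* u :=
                 (h :* (h :* (h :* h))) :* ((g :* g :* (g :* g) :* (N :* N) :* N) :* u)) refl h g N (v k₄) ⟩
          (h * (h * (h * h))) * (G * v k₄) ≈⟨ *-congʳ (sym s-eq) ⟩
          (s * p) * (G * v k₄) ≈⟨ solve 4 (λ s p G u → (s :* p) :* (G :* u) := ((s :* G) :* u) :* p) refl s p G (v k₄) ⟩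
          ((s * G) * v k₄) * p ∎)
        t⁸ : p ∣ ((t * t) * (t * t)) * ((t * t) * (t * t))
        t⁸ = ((s * G) * (s * G)) * (N * v (k₄ ℕ.+ k₄)) , (begin
          ((s * G) * (s * G)) * (N * v (k₄ ℕ.+ k₄)) * p
            ≈⟨ solve 4 (λ y N u p → ((y :* y) :* (N :* u)) :* p := (y :* y) :* ((N :* p) :* u)) refl (s * G) N (v (k₄ ℕ.+ k₄)) p ⟩
          ((s * G) * (s * G)) * ((N * p) * v (k₄ ℕ.+ k₄)) ≈⟨ *-congˡ (sym (square k₄)) ⟩
          ((s * G) * (s * G)) * (v k₄ * v k₄) ≈⟨ solve 2 (λ g u → (g :* g) :* (u :* u) := (g :* u) :* (g :* u)) refl (s * G) (v k₄) ⟩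
          ((s * G) * v k₄) * ((s * G) * v k₄) ≈⟨ *-cong (sym t⁴) (sym t⁴) ⟩
          ((t * t) * (t * t)) * ((t * t) * (t * t)) ∎)

  ∣-square-* : ∀ {d} x {y} → d ∣ y * y → d ∣ (x * y) * (x * y)
  ∣-square-* x {y} d∣y² = ∣-respʳ (solve 2 (λ x y → x :* x :* (y :* y) := (x :* y) :* (x :* y)) refl x y)
    (x∣ʳy⇒x∣ʳzy (x * x) d∣y²)

  square-sequence-factor : ∀ {N p v} → SquareSequence (N * p) v → ∀ k → v k * v k ≈ (N * v (k ℕ.+ k)) * p
  square-sequence-factor {N} {p} {v} square k = trans (square k)
    (solve 3 (λ N p u → (N :* p) :* u := (N :* u) :* p) refl N p (v (k ℕ.+ k)))

  -- Modulo p all terms of the quartic from w² upwards vanish, which leaves w t₃ + t₄. Multiplying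
  -- by w once more removes w t₃ as well.
  nilpotent-quartic-root : ∀ {p w t₁ t₂ t₃ t₄} → t₄ + w * (t₃ + w * (t₂ + w * (t₁ + w))) ≈ 0# →
    p ∣ w * w → p ∣ w * t₃ + t₄ × p ∣ w * t₄
  nilpotent-quartic-root {p} {w} {t₁} {t₂} {t₃} {t₄} root p∣w² = p∣linear ,
    ∣-+-cancelˡ (∣-*ʳ t₃ p∣w²) (∣-respʳ
      (solve 3 (λ w t₃ t₄ → (w :* t₃ :+ t₄) :* w := w :* w :* t₃ :+ w :* t₄) refl w t₃ t₄) (∣-*ʳ w p∣linear))
    where
    p∣linear : p ∣ w * t₃ + t₄
    p∣linear = ∣-+-cancelˡ (∣-*ʳ (t₂ + w * (t₁ + w)) p∣w²) (∣-respʳ (trans (sym root)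
      (solve 5 (λ w t₁ t₂ t₃ t₄ → t₄ :+ w :* (t₃ :+ w :* (t₂ :+ w :* (t₁ :+ w))) :=
        w :* w :* (t₂ :+ w :* (t₁ :+ w)) :+ (w :* t₃ :+ t₄)) refl w t₁ t₂ t₃ t₄)) (0# , zeroˡ p))

open import Algebra.Consequences.Propositional using (comm∧idˡ⇒id; comm∧invˡ⇒inv; comm∧distrʳ⇒distr)
open import Data.Fin using (#_)
open import Data.Integer as ℤ using (ℤ; +_; _+_; _*_; -_; 0ℤ; 1ℤ; NonZero; _%ℕ_; _/ℕ_)
open import Data.Integer.DivMod using (a≡a%ℕn+[a/ℕn]*n)
open import Data.Integer.Divisibility.Signed
import Data.Integer.Properties as ℤₚ
open import Data.Integer.Tactic.RingSolver using (ring; solve-∀)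
open import Data.List.Relation.Unary.All as All using (All; []; _∷_; all?)
import Data.Nat.Divisibility as ℕ
open import Data.Nat.GCD using (gcd-greatest)
open import Data.Nat.ListAction using (product)
open import Data.Nat.Primality using (Prime; prime?; prime[2]; prime⇒nonZero; ¬prime[1]; euclidsLemma)
open import Data.Nat.Primality.Factorisation using (factorise; PrimeFactorisation)
open import Data.Rational as ℚ using (ℚ; 0ℚ; 1ℚ; ↥_; ↧_; ↧ₙ_; toℚᵘ)
import Data.Rational.Properties as ℚₚ
open import Data.Rational.Solver using (module +-*-Solver)
open import Data.Rational.Unnormalised as ℚᵘ using (mkℚᵘ; *≡*)
import Data.Rational.Unnormalised.Properties as ℚᵘₚ
open import Data.Sum as Sum using (_⊎_; inj₁; inj₂; [_,_]′)
open import Data.Vec using (Vec; []; _∷_)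
open import Function using (id; _∘_; mk⇔)
open import Level using (0ℓ)
open ≡ hiding ([_])
import Tactic.RingSolver.NonReflective ring as Solver
open Solver using (Expr; Κ; Ι; _⊕_; _⊗_; ⊝_)

-- The order ℤ[θ] as quadruples of integers.

record Quad (C : Set) : Set where
  constructor quad
  field
    π₀ π₁ π₂ π₃ : C
open Quad

mapQ : ∀ {A B : Set} → (A → B) → Quad A → Quad B
mapQ f (quad x₀ x₁ x₂ x₃) = quad (f x₀) (f x₁) (f x₂) (f x₃)

quad-≡ : ∀ {A : Set} {x y : Quad A} → π₀ x ≡ π₀ y → π₁ x ≡ π₁ y → π₂ x ≡ π₂ y → π₃ x ≡ π₃ y → x ≡ y
quad-≡ refl refl refl refl = refl

-- The sum, the product and `mulθQ` repeat the formulas of `_+K_`, `_*K_` and `mulθ`, so that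
-- `embed-*` can proceed summand by summand.
module Quartic {C : Set} (_+_ _*_ : C → C → C) (-_ : C → C) (0# 1# a b : C) where

  infixl 6 _+Q_
  infixl 7 _*Q_

  const : C → Quad C
  const c = quad c 0# 0# 0#

  0Q 1Q θQ : Quad C
  0Q = const 0#
  1Q = const 1#
  θQ = quad 0# 1# 0# 0#

  _+Q_ _*Q_ : Quad C → Quad C → Quad C
  -Q_ mulθQ : Quad C → Quad C
  scaleQ : C → Quad C → Quad C
  quad x₀ x₁ x₂ x₃ +Q quad y₀ y₁ y₂ y₃ = quad (x₀ + y₀) (x₁ + y₁) (x₂ + y₂) (x₃ + y₃)
  -Q_ = mapQ -_
  scaleQ r = mapQ (r *_)
  mulθQ (quad y₀ y₁ y₂ y₃) = quad (- (b * y₃)) (y₀ + (- (a * y₃))) y₁ y₂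
  quad x₀ x₁ x₂ x₃ *Q y = scaleQ x₀ y +Q (scaleQ x₁ (mulθQ y) +Q
    (scaleQ x₂ (mulθQ (mulθQ y)) +Q scaleQ x₃ (mulθQ (mulθQ (mulθQ y)))))

  private
    det₂ : (p q r s : C) → C
    det₂ p q r s = (p * s) + (- (q * r))
    det₃ : (p q r s t u v w x : C) → C
    det₃ p q r s t u v w x = (p * det₂ t u w x) + ((- (q * det₂ s u v x)) + (r * det₂ s t v w))

  -- The characteristic polynomial of multiplication by w is X⁴ − e₁ X³ + e₂ X² − e₃ X + e₄;
  -- each eᵢ is the sum of the principal i × i minors of the matrix with rows w, θw, θ²w, θ³w.
  e₁ e₂ e₃ e₄ : Quad C → C
  e₁ w = (π₀ w + π₁ (mulθQ w)) + (π₂ (mulθQ (mulθQ w)) + π₃ (mulθQ (mulθQ (mulθQ w))))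
  e₂ w = minors w (mulθQ w) (mulθQ (mulθQ w)) (mulθQ (mulθQ (mulθQ w)))
    where
    minors : (w x y z : Quad C) → C
    minors (quad w₀ w₁ w₂ w₃) (quad x₀ x₁ x₂ x₃) (quad y₀ y₁ y₂ y₃) (quad z₀ z₁ z₂ z₃) =
      (det₂ w₀ w₁ x₀ x₁ + (det₂ w₀ w₂ y₀ y₂ + det₂ w₀ w₃ z₀ z₃)) +
      (det₂ x₁ x₂ y₁ y₂ + (det₂ x₁ x₃ z₁ z₃ + det₂ y₂ y₃ z₂ z₃))
  e₃ w = minors w (mulθQ w) (mulθQ (mulθQ w)) (mulθQ (mulθQ (mulθQ w)))
    where
    minors : (w x y z : Quad C) → C
    minors (quad w₀ w₁ w₂ w₃) (quad x₀ x₁ x₂ x₃) (quad y₀ y₁ y₂ y₃) (quad z₀ z₁ z₂ z₃) =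
      (det₃ w₀ w₁ w₂ x₀ x₁ x₂ y₀ y₁ y₂ + det₃ w₀ w₁ w₃ x₀ x₁ x₃ z₀ z₁ z₃) +
      (det₃ w₀ w₂ w₃ y₀ y₂ y₃ z₀ z₂ z₃ + det₃ x₁ x₂ x₃ y₁ y₂ y₃ z₁ z₂ z₃)
  e₄ w = minors w (mulθQ w) (mulθQ (mulθQ w)) (mulθQ (mulθQ (mulθQ w)))
    where
    minors : (w x y z : Quad C) → C
    minors (quad w₀ w₁ w₂ w₃) (quad x₀ x₁ x₂ x₃) (quad y₀ y₁ y₂ y₃) (quad z₀ z₁ z₂ z₃) =
      ((w₀ * det₃ x₁ x₂ x₃ y₁ y₂ y₃ z₁ z₂ z₃) + (- (w₁ * det₃ x₀ x₂ x₃ y₀ y₂ y₃ z₀ z₂ z₃))) +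
      ((w₂ * det₃ x₀ x₁ x₃ y₀ y₁ y₃ z₀ z₁ z₃) + (- (w₃ * det₃ x₀ x₁ x₂ y₀ y₁ y₂ z₀ z₁ z₂)))

-- The operations applied to solver expressions, so that an identity between
-- quadruples is stated to the solver in the same notation as over ℤ.
module Symbolic {n : ℕ} = Quartic {Expr ℤ (suc (suc n))} _⊕_ _⊗_ ⊝_ (Κ 0ℤ) (Κ 1ℤ) (Ι (# 0)) (Ι (# 1))

module _ {n : ℕ} (ρ : Vec ℤ n) where
  open Solver.Ops using (⟦_⟧; ⟦_⇓⟧; correct)

  solveℤ : (l r : Expr ℤ n) → ⟦ l ⇓⟧ ρ ≡ ⟦ r ⇓⟧ ρ → ⟦ l ⟧ ρ ≡ ⟦ r ⟧ ρ
  solveℤ l r eq = trans (sym (correct l ρ)) (trans eq (correct r ρ))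

  solveQ : (l r : Quad (Expr ℤ n)) → mapQ (λ e → ⟦ e ⇓⟧ ρ) l ≡ mapQ (λ e → ⟦ e ⇓⟧ ρ) r →
    mapQ (λ e → ⟦ e ⟧ ρ) l ≡ mapQ (λ e → ⟦ e ⟧ ρ) r
  solveQ l r eq = quad-≡ (solveℤ (π₀ l) (π₀ r) (cong π₀ eq)) (solveℤ (π₁ l) (π₁ r) (cong π₁ eq))
    (solveℤ (π₂ l) (π₂ r) (cong π₂ eq)) (solveℤ (π₃ l) (π₃ r) (cong π₃ eq))

module Order (a b : ℤ) where
  module R = Quartic _+_ _*_ -_ 0ℤ 1ℤ a b
  open R public using (const; 0Q; 1Q; θQ)
  module S = Symbolic

  env₁ : Quad ℤ → Vec ℤ 6
  env₁ (quad x₀ x₁ x₂ x₃) = a ∷ b ∷ x₀ ∷ x₁ ∷ x₂ ∷ x₃ ∷ []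

  env₂ : Quad ℤ → Quad ℤ → Vec ℤ 10
  env₂ (quad x₀ x₁ x₂ x₃) (quad y₀ y₁ y₂ y₃) = a ∷ b ∷ x₀ ∷ x₁ ∷ x₂ ∷ x₃ ∷ y₀ ∷ y₁ ∷ y₂ ∷ y₃ ∷ []

  env₃ : Quad ℤ → Quad ℤ → Quad ℤ → Vec ℤ 14
  env₃ (quad x₀ x₁ x₂ x₃) (quad y₀ y₁ y₂ y₃) (quad z₀ z₁ z₂ z₃) =
    a ∷ b ∷ x₀ ∷ x₁ ∷ x₂ ∷ x₃ ∷ y₀ ∷ y₁ ∷ y₂ ∷ y₃ ∷ z₀ ∷ z₁ ∷ z₂ ∷ z₃ ∷ []

  X : ∀ {n} → Quad (Expr ℤ (6 ℕ.+ n))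
  X = quad (Ι (# 2)) (Ι (# 3)) (Ι (# 4)) (Ι (# 5))

  Y : ∀ {n} → Quad (Expr ℤ (10 ℕ.+ n))
  Y = quad (Ι (# 6)) (Ι (# 7)) (Ι (# 8)) (Ι (# 9))

  Z : Quad (Expr ℤ 14)
  Z = quad (Ι (# 10)) (Ι (# 11)) (Ι (# 12)) (Ι (# 13))

  infixl 6 _+Q_
  infixl 7 _*Q_

  -- Opaque, because comparing products of quadruples up to unfolding is prohibitively slow.
  opaque
    _+Q_ _*Q_ : Quad ℤ → Quad ℤ → Quad ℤ
    _+Q_ = R._+Q_
    _*Q_ = R._*Q_

    -Q_ : Quad ℤ → Quad ℤ
    -Q_ = R.-Q_

    e₁ e₂ e₃ e₄ : Quad ℤ → ℤ
    e₁ = R.e₁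
    e₂ = R.e₂
    e₃ = R.e₃
    e₄ = R.e₄

  opaque
    unfolding _+Q_ _*Q_ -Q_ e₁ e₂ e₃ e₄

    *Q-assoc : ∀ x y z → (x *Q y) *Q z ≡ x *Q (y *Q z)
    *Q-assoc x y z = solveQ (env₃ x y z) ((X S.*Q Y) S.*Q Z) (X S.*Q (Y S.*Q Z)) refl

    *Q-comm : ∀ x y → x *Q y ≡ y *Q x
    *Q-comm x y = solveQ (env₂ x y) (X S.*Q Y) (Y S.*Q X) refl

    *Q-distribʳ-+Q : ∀ x y z → (y +Q z) *Q x ≡ y *Q x +Q z *Q x
    *Q-distribʳ-+Q x y z = solveQ (env₃ x y z) ((Y S.+Q Z) S.*Q X) (Y S.*Q X S.+Q Z S.*Q X) refl

    *Q-identityˡ : ∀ x → 1Q *Q x ≡ x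
    *Q-identityˡ x = solveQ (env₁ x) (S.1Q S.*Q X) X refl

    cayley-hamilton : ∀ w →
      const (e₄ w) +Q w *Q (const (- (e₃ w)) +Q w *Q (const (e₂ w) +Q w *Q (const (- (e₁ w)) +Q w))) ≡ 0Q
    cayley-hamilton w = solveQ (env₁ w) (S.const (S.e₄ X) S.+Q X S.*Q (S.const (⊝ (S.e₃ X)) S.+Q
      X S.*Q (S.const (S.e₂ X) S.+Q X S.*Q (S.const (⊝ (S.e₁ X)) S.+Q X)))) S.0Q refl

    +Q-assoc : ∀ x y z → (x +Q y) +Q z ≡ x +Q (y +Q z)
    +Q-assoc x y z = solveQ (env₃ x y z) ((X S.+Q Y) S.+Q Z) (X S.+Q (Y S.+Q Z)) refl

    +Q-comm : ∀ x y → x +Q y ≡ y +Q x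
    +Q-comm x y = solveQ (env₂ x y) (X S.+Q Y) (Y S.+Q X) refl

    +Q-identityˡ : ∀ x → 0Q +Q x ≡ x
    +Q-identityˡ x = solveQ (env₁ x) (S.0Q S.+Q X) X refl

    +Q-inverseˡ : ∀ x → (-Q x) +Q x ≡ 0Q
    +Q-inverseˡ x = solveQ (env₁ x) ((S.-Q X) S.+Q X) S.0Q refl

  commutativeRing : CommutativeRing 0ℓ 0ℓ
  commutativeRing = record
    { Carrier = Quad ℤ ; _≈_ = _≡_ ; _+_ = _+Q_ ; _*_ = _*Q_ ; -_ = -Q_ ; 0# = 0Q ; 1# = 1Q
    ; isCommutativeRing = record
      { isRing = record
        { +-isAbelianGroup = record
          { isGroup = record
            { isMonoid = record
              { isSemigroup = record
                { isMagma = record { isEquivalence = isEquivalence ; ∙-cong = cong₂ _+Q_ }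
                ; assoc = +Q-assoc }
              ; identity = comm∧idˡ⇒id +Q-comm +Q-identityˡ }
            ; inverse = comm∧invˡ⇒inv +Q-comm +Q-inverseˡ
            ; ⁻¹-cong = cong -Q_ }
          ; comm = +Q-comm }
        ; *-cong = cong₂ _*Q_
        ; *-assoc = *Q-assoc
        ; *-identity = comm∧idˡ⇒id *Q-comm *Q-identityˡ
        ; distrib = comm∧distrʳ⇒distr (cong₂ _+Q_) *Q-comm *Q-distribʳ-+Q }
      ; *-comm = *Q-comm }
    }

-- Divisibility by primes in ℤ.

∣-unneg : ∀ {m n} → m ∣ - n → m ∣ n
∣-unneg {m} {n} d = subst (m ∣_) (ℤₚ.neg-involutive n) (∣m⇒∣-m d)

-- The one property of a prime, besides p ≠ 0, on which the modules parametrised by `euclid` rest.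
EuclidsLemma : ℤ → Set
EuclidsLemma p = ∀ m n → p ∣ m * n → p ∣ m ⊎ p ∣ n

prime⇒euclid : ∀ {p} → Prime p → EuclidsLemma (+ p)
prime⇒euclid {p} pr m n p∣mn =
  Sum.map ∣ᵤ⇒∣ ∣ᵤ⇒∣ (euclidsLemma ℤ.∣ m ∣ ℤ.∣ n ∣ pr (subst (p ℕ.∣_) (ℤₚ.abs-* m n) (∣⇒∣ᵤ p∣mn)))

module _ {p : ℤ} .{{_ : NonZero p}} (euclid : EuclidsLemma p) where

  -- If p does not divide n, both factors p come from m: `euclid` finds the first, and after
  -- cancelling it `euclid` finds the second.
  p²∣mn⇒p²∣m⊎p∣n : ∀ m n → p * p ∣ m * n → p * p ∣ m ⊎ p ∣ n
  p²∣mn⇒p²∣m⊎p∣n m n p²∣mn@(divides q eq) with euclid m n (∣-trans (∣m⇒∣m*n p ∣-refl) p²∣mn)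
  ... | inj₂ p∣n = inj₂ p∣n
  ... | inj₁ (divides m′ refl) = Sum.map₁ (*-monoˡ-∣ p) (euclid m′ n
    (divides q (ℤₚ.*-cancelʳ-≡ (m′ * n) (q * p) p (trans (swap m′ n p) (trans eq (sym (ℤₚ.*-assoc q p p)))))))
    where
    swap : ∀ x y z → x * y * z ≡ x * z * y
    swap = solve-∀

  p²∤m∧p²∣mn²⇒p∣n : ∀ {m n} → ¬ p * p ∣ m → p * p ∣ m * n * n → p ∣ n
  p²∤m∧p²∣mn²⇒p∣n {m} {n} p²∤m p²∣mn² with p²∣mn⇒p²∣m⊎p∣n (m * n) n p²∣mn²
  ... | inj₂ p∣n = p∣n
  ... | inj₁ p²∣mn = [ (λ p²∣m → contradiction p²∣m p²∤m) , id ]′ (p²∣mn⇒p²∣m⊎p∣n m n p²∣mn)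

  ∣-cancelˡ : ∀ {m n} → ¬ p ∣ m → p ∣ m * n → p ∣ n
  ∣-cancelˡ {m} {n} p∤m d = [ (λ p∣m → contradiction p∣m p∤m) , id ]′ (euclid m n d)

  -- Used with α = 3a, β = b, γ = 3a², where the four relations are the traces of w, wθ, wθ², wθ³.
  -- They are solved triangularly: if p ∤ α in the order x₂, x₁, x₀ with pivot α, and if p ∣ α in
  -- the order x₀, x₁, x₂ with pivots 4, 4β, 4β.
  trace-relations⇒∣ : ∀ α β γ x₀ x₁ x₂ x₃ → ¬ (p ∣ α × p ∣ + 4 * β) → p ∣ x₃ →
    p ∣ + 4 * x₀ + - (α * x₃) → p ∣ - (α * x₂ + + 4 * β * x₃) → p ∣ - (α * x₁ + + 4 * β * x₂) →
    p ∣ - (α * x₀ + + 4 * β * x₁) + γ * x₃ → p ∣ x₀ × p ∣ x₁ × p ∣ x₂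
  trace-relations⇒∣ α β γ x₀ x₁ x₂ x₃ p∤ p∣x₃ r₀ r₁ r₂ r₃ = conclude (p ∣? α)
    where
    s₀ : p ∣ + 4 * x₀
    s₀ = ∣m+n∣n⇒∣m {m = + 4 * x₀} r₀ (∣m⇒∣-m (∣n⇒∣m*n α p∣x₃))
    s₁ : p ∣ α * x₂
    s₁ = ∣m+n∣n⇒∣m {m = α * x₂} (∣-unneg {p} {α * x₂ + + 4 * β * x₃} r₁) (∣n⇒∣m*n (+ 4 * β) p∣x₃)
    s₃ : p ∣ α * x₀ + + 4 * β * x₁
    s₃ = ∣-unneg (∣m+n∣n⇒∣m {m = - (α * x₀ + + 4 * β * x₁)} r₃ (∣n⇒∣m*n γ p∣x₃))
    conclude : Dec (p ∣ α) → p ∣ x₀ × p ∣ x₁ × p ∣ x₂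
    conclude (no p∤α) = p∣x₀ , p∣x₁ , p∣x₂
      where
      p∣x₂ : p ∣ x₂
      p∣x₂ = ∣-cancelˡ {α} {x₂} p∤α s₁
      p∣x₁ : p ∣ x₁
      p∣x₁ = ∣-cancelˡ {α} {x₁} p∤α (∣m+n∣n⇒∣m {m = α * x₁} (∣-unneg {p} {α * x₁ + + 4 * β * x₂} r₂) (∣n⇒∣m*n (+ 4 * β) p∣x₂))
      p∣x₀ : p ∣ x₀
      p∣x₀ = ∣-cancelˡ {α} {x₀} p∤α (∣m+n∣n⇒∣m {m = α * x₀} s₃ (∣n⇒∣m*n (+ 4 * β) p∣x₁))
    conclude (yes p∣α) = p∣x₀ , p∣x₁ , p∣x₂
      where
      p∤4β : ¬ p ∣ + 4 * β
      p∤4β p∣4β = p∤ (p∣α , p∣4β)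
      p∣x₀ : p ∣ x₀
      p∣x₀ = ∣-cancelˡ {+ 4} {x₀} (λ p∣4 → p∤4β (∣m⇒∣m*n {m = + 4} β p∣4)) s₀
      p∣x₁ : p ∣ x₁
      p∣x₁ = ∣-cancelˡ {+ 4 * β} {x₁} p∤4β (∣m+n∣m⇒∣n {m = α * x₀} s₃ (∣n⇒∣m*n α p∣x₀))
      p∣x₂ : p ∣ x₂
      p∣x₂ = ∣-cancelˡ {+ 4 * β} {x₂} p∤4β (∣m+n∣m⇒∣n {m = α * x₁} (∣-unneg {p} {α * x₁ + + 4 * β * x₂} r₂) (∣n⇒∣m*n α p∣x₁))

∣-*-∣ : ∀ {d m n} → d ∣ m → d ∣ n → d * d ∣ m * n
∣-*-∣ {d} {m} d∣m d∣n = ∣-trans (*-monoˡ-∣ d d∣m) (*-monoʳ-∣ m d∣n)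

-- The pattern of signs is that of the right side of `trace-form`.
∣-combination : ∀ {d} k₀ k₁ k₂ k₃ {x₀ x₁ x₂ x₃} → d ∣ x₀ → d ∣ x₁ → d ∣ x₂ → d ∣ x₃ →
  d ∣ (k₀ * x₀ + - (k₁ * x₁)) + (k₂ * x₂ + - (k₃ * x₃))
∣-combination k₀ k₁ k₂ k₃ d₀ d₁ d₂ d₃ = ∣m∣n⇒∣m+n (∣m∣n⇒∣m+n (∣n⇒∣m*n k₀ d₀) (∣m⇒∣-m (∣n⇒∣m*n k₁ d₁)))
  (∣m∣n⇒∣m+n (∣n⇒∣m*n k₂ d₂) (∣m⇒∣-m (∣n⇒∣m*n k₃ d₃)))

-- Traces, and maximality at primes outside the gcd.

module OrderDivisibility (a b : ℤ) where
  open Order a b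
  open CommutativeRingLemmas commutativeRing
  open CommutativeRing commutativeRing using (*-commutativeSemigroup)
  open import Algebra.Properties.CommutativeSemigroup.Divisibility *-commutativeSemigroup
    using (_∣ʳ_; x∣ʳy⇒x∣ʳzy) renaming (_,_ to infixr 4 _,ʳ_)

  infix 4 _∣Q_ _∣ᶜ_

  _∣Q_ : ℤ → Quad ℤ → Set
  d ∣Q w = const d ∣ʳ w

  _∣ᶜ_ : ℤ → Quad ℤ → Set
  d ∣ᶜ w = d ∣ π₀ w × d ∣ π₁ w × d ∣ π₂ w × d ∣ π₃ w

  Δ : ℤ
  Δ = + 256 * (b * b * b) + - (+ 27 * (a * a * a * a))

  opaque
    unfolding _*Q_ e₁ e₃

    *Q-const : ∀ w d → w *Q const d ≡ mapQ (_* d) w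
    *Q-const w@(quad x₀ x₁ x₂ x₃) d = solveQ (a ∷ b ∷ x₀ ∷ x₁ ∷ x₂ ∷ x₃ ∷ d ∷ [])
      (X S.*Q S.const (Ι (# 6))) (mapQ (_⊗ Ι (# 6)) X) refl

    e₁-*const : ∀ w d → e₁ (w *Q const d) ≡ e₁ w * d
    e₁-*const (quad x₀ x₁ x₂ x₃) d = solveℤ (a ∷ b ∷ x₀ ∷ x₁ ∷ x₂ ∷ x₃ ∷ d ∷ [])
      (S.e₁ (X S.*Q S.const (Ι (# 6)))) (S.e₁ X ⊗ Ι (# 6)) refl

    -- Newton's identities for the first three power sums, with e₂ eliminated.
    newton : ∀ w → e₁ w * (e₁ w * e₁ w) ≡
      + 3 * e₁ w * e₁ (w *Q w) + (+ 6 * e₃ w + - (+ 2 * e₁ (w *Q (w *Q w))))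
    newton w = solveℤ (env₁ w) (S.e₁ X ⊗ (S.e₁ X ⊗ S.e₁ X))
      (Κ (+ 3) ⊗ S.e₁ X ⊗ S.e₁ (X S.*Q X) ⊕ (Κ (+ 6) ⊗ S.e₃ X ⊕ (⊝ (Κ (+ 2) ⊗ S.e₁ (X S.*Q (X S.*Q X)))))) refl

    -- The traces of 1, θ, ..., θ⁶ are 4, 0, 0, -3a, -4b, 0, 3a². This formula and the three after
    -- it follow by linearity.
    e₁-formula : ∀ w → e₁ w ≡ + 4 * π₀ w + - (+ 3 * a * π₃ w)
    e₁-formula w = solveℤ (env₁ w) (S.e₁ X) (Κ (+ 4) ⊗ π₀ X ⊕ (⊝ (Κ (+ 3) ⊗ Ι (# 0) ⊗ π₃ X))) refl

    e₁-θ-formula : ∀ w → e₁ (θQ *Q w) ≡ - (+ 3 * a * π₂ w + + 4 * b * π₃ w)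
    e₁-θ-formula w = solveℤ (env₁ w) (S.e₁ (S.θQ S.*Q X))
      (⊝ (Κ (+ 3) ⊗ Ι (# 0) ⊗ π₂ X ⊕ Κ (+ 4) ⊗ Ι (# 1) ⊗ π₃ X)) refl

    e₁-θ²-formula : ∀ w → e₁ (θQ *Q (θQ *Q w)) ≡ - (+ 3 * a * π₁ w + + 4 * b * π₂ w)
    e₁-θ²-formula w = solveℤ (env₁ w) (S.e₁ (S.θQ S.*Q (S.θQ S.*Q X)))
      (⊝ (Κ (+ 3) ⊗ Ι (# 0) ⊗ π₁ X ⊕ Κ (+ 4) ⊗ Ι (# 1) ⊗ π₂ X)) refl

    e₁-θ³-formula : ∀ w → e₁ (θQ *Q (θQ *Q (θQ *Q w))) ≡
      - (+ 3 * a * π₀ w + + 4 * b * π₁ w) + + 3 * a * a * π₃ w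
    e₁-θ³-formula w = solveℤ (env₁ w) (S.e₁ (S.θQ S.*Q (S.θQ S.*Q (S.θQ S.*Q X))))
      ((⊝ (Κ (+ 3) ⊗ Ι (# 0) ⊗ π₀ X ⊕ Κ (+ 4) ⊗ Ι (# 1) ⊗ π₁ X)) ⊕ Κ (+ 3) ⊗ Ι (# 0) ⊗ Ι (# 0) ⊗ π₃ X) refl

    -- Completing squares in 36a² Tr(w²): T₀ absorbs w₀, the product T₁ T₂ absorbs w₁, and T₁²
    -- corrects the terms in w₂. Only w₃² remains, with 81a⁴ + 256b³ - 108a⁴ = Δ as coefficient.
    trace-form : ∀ w → let T₀ = e₁ w ; T₁ = e₁ (θQ *Q w) ; T₂ = e₁ (θQ *Q (θQ *Q w)) in
      Δ * π₃ w * π₃ w ≡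
        (+ 9 * a * a * (T₀ * T₀) + - (+ 24 * a * (T₁ * T₂))) +
        (+ 16 * b * (T₁ * T₁) + - (+ 36 * a * a * e₁ (w *Q w)))
    trace-form w = solveℤ (env₁ w) (Δ′ ⊗ π₃ X ⊗ π₃ X)
      ((Κ (+ 9) ⊗ a′ ⊗ a′ ⊗ (T₀ ⊗ T₀) ⊕ (⊝ (Κ (+ 24) ⊗ a′ ⊗ (T₁ ⊗ T₂)))) ⊕
       (Κ (+ 16) ⊗ b′ ⊗ (T₁ ⊗ T₁) ⊕ (⊝ (Κ (+ 36) ⊗ a′ ⊗ a′ ⊗ S.e₁ (X S.*Q X))))) refl
      where
      a′ b′ T₀ T₁ T₂ Δ′ : Expr ℤ 6
      a′ = Ι (# 0)
      b′ = Ι (# 1)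
      T₀ = S.e₁ X
      T₁ = S.e₁ (S.θQ S.*Q X)
      T₂ = S.e₁ (S.θQ S.*Q (S.θQ S.*Q X))
      Δ′ = Κ (+ 256) ⊗ (b′ ⊗ b′ ⊗ b′) ⊕ (⊝ (Κ (+ 27) ⊗ (a′ ⊗ a′ ⊗ a′ ⊗ a′)))

  ∣Q⇒∣ᶜ : ∀ {d w} → d ∣Q w → d ∣ᶜ w
  ∣Q⇒∣ᶜ {d} {w} (q ,ʳ eq) =
    divides (π₀ q) (cong π₀ w≡) , divides (π₁ q) (cong π₁ w≡) , divides (π₂ q) (cong π₂ w≡) , divides (π₃ q) (cong π₃ w≡)
    where
    w≡ : w ≡ mapQ (_* d) q
    w≡ = trans (sym eq) (*Q-const q d)

  ∣ᶜ⇒∣Q : ∀ {d w} → d ∣ᶜ w → d ∣Q w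
  ∣ᶜ⇒∣Q {d} (divides q₀ e₀ , divides q₁ e₁ , divides q₂ e₂ , divides q₃ e₃) =
    quad q₀ q₁ q₂ q₃ ,ʳ trans (*Q-const (quad q₀ q₁ q₂ q₃) d) (quad-≡ (sym e₀) (sym e₁) (sym e₂) (sym e₃))

  const-regular : ∀ d .{{_ : NonZero d}} → Regular (const d)
  const-regular d {x} {y} eq =
    quad-≡ (cancel (cong π₀ eq′)) (cancel (cong π₁ eq′)) (cancel (cong π₂ eq′)) (cancel (cong π₃ eq′))
    where
    eq′ : mapQ (_* d) x ≡ mapQ (_* d) y
    eq′ = trans (sym (*Q-const x d)) (trans eq (*Q-const y d))
    cancel : ∀ {m n} → m * d ≡ n * d → m ≡ n
    cancel = ℤₚ.*-cancelʳ-≡ _ _ d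

  ∣Q⇒∣e₁ : ∀ {d w} → d ∣Q w → d ∣ e₁ w
  ∣Q⇒∣e₁ {d} (q ,ʳ refl) = divides (e₁ q) (e₁-*const q d)

  module _ {p : ℤ} .{{_ : NonZero p}} (euclid : EuclidsLemma p) where

    euclidᶜ : ∀ c w → p ∣ᶜ mapQ (_* c) w → p ∣ c ⊎ p ∣ᶜ w
    euclidᶜ c (quad x₀ x₁ x₂ x₃) (d₀ , d₁ , d₂ , d₃)
      with euclid x₀ c d₀ | euclid x₁ c d₁ | euclid x₂ c d₂ | euclid x₃ c d₃
    ... | inj₂ p∣c | _ | _ | _ = inj₁ p∣c
    ... | _ | inj₂ p∣c | _ | _ = inj₁ p∣c
    ... | _ | _ | inj₂ p∣c | _ = inj₁ p∣c
    ... | _ | _ | _ | inj₂ p∣c = inj₁ p∣c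
    ... | inj₁ p∣x₀ | inj₁ p∣x₁ | inj₁ p∣x₂ | inj₁ p∣x₃ = inj₂ (p∣x₀ , p∣x₁ , p∣x₂ , p∣x₃)

    euclidQ : ∀ w c → p ∣Q w *Q const c → p ∣ c ⊎ p ∣Q w
    euclidQ w c p∣wc = Sum.map₂ ∣ᶜ⇒∣Q (euclidᶜ c w (subst (p ∣ᶜ_) (*Q-const w c) (∣Q⇒∣ᶜ p∣wc)))

    -- Unless p divides w itself, Cayley-Hamilton modulo p forces p ∣ e₄ and then p ∣ e₃. In
    -- `newton` every term on the right is then divisible by p, and e₁³ has coefficient 1, so the
    -- argument covers p = 2 and p = 3.
    nilpotent⇒∣e₁ : ∀ w → p ∣Q w *Q w → p ∣ e₁ w
    nilpotent⇒∣e₁ w p∣w² = [ id , ∣Q⇒∣e₁ ]′ (case-e₄ (euclidQ w t₄ p∣wt₄))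
      where
      t₃ t₄ : ℤ
      t₃ = - (e₃ w)
      t₄ = e₄ w
      both : p ∣Q w *Q const t₃ +Q const t₄ × p ∣Q w *Q const t₄
      both = nilpotent-quartic-root {w = w} {const (- (e₁ w))} {const (e₂ w)} {const t₃} {const t₄} (cayley-hamilton w) p∣w²
      p∣linear : p ∣Q w *Q const t₃ +Q const t₄
      p∣linear = proj₁ both
      p∣wt₄ : p ∣Q w *Q const t₄
      p∣wt₄ = proj₂ both
      case-e₃ : p ∣ t₃ ⊎ p ∣Q w → p ∣ e₁ w ⊎ p ∣Q w
      case-e₃ (inj₂ p∣w) = inj₂ p∣w
      case-e₃ (inj₁ p∣t₃) = inj₁ ([ id , (λ d → [ id , id ]′ (euclid (e₁ w) (e₁ w) d)) ]′
        (euclid (e₁ w) (e₁ w * e₁ w) (subst (p ∣_) (sym (newton w))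
        (∣m∣n⇒∣m+n (∣n⇒∣m*n (+ 3 * e₁ w) (∣Q⇒∣e₁ p∣w²))
          (∣m∣n⇒∣m+n (∣n⇒∣m*n (+ 6) (∣-unneg {p} {e₃ w} p∣t₃))
            (∣m⇒∣-m (∣n⇒∣m*n (+ 2) (∣Q⇒∣e₁ (x∣ʳy⇒x∣ʳzy w p∣w²)))))))))
      case-e₄ : p ∣ t₄ ⊎ p ∣Q w → p ∣ e₁ w ⊎ p ∣Q w
      case-e₄ (inj₂ p∣w) = inj₂ p∣w
      case-e₄ (inj₁ p∣t₄) = case-e₃ (euclidQ w t₃ (∣-+-cancelˡ (∣ᶜ⇒∣Q (p∣t₄ , 0∣ , 0∣ , 0∣))
        (subst (p ∣Q_) (+Q-comm (w *Q const t₃) (const t₄)) p∣linear)))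
        where
        0∣ : p ∣ 0ℤ
        0∣ = divides 0ℤ refl

    discriminant-maximal : ¬ p * p ∣ Δ → ¬ (p ∣ + 3 * a × p ∣ + 4 * b) → MaximalAt (const p)
    discriminant-maximal p²∤Δ p∤g N v square k = ∣ᶜ⇒∣Q (proj₁ rest , proj₁ (proj₂ rest) , proj₂ (proj₂ rest) , p∣w₃)
      where
      w = v k
      u = N *Q v (k ℕ.+ k)
      w²≡up : w *Q w ≡ u *Q const p
      w²≡up = square-sequence-factor square k
      p∣w² : p ∣Q w *Q w
      p∣w² = u ,ʳ sym w²≡up
      p∣v² : ∀ j → p ∣Q v j *Q v j
      p∣v² j = N *Q v (j ℕ.+ j) ,ʳ sym (square-sequence-factor square j)
      T₀ = e₁ w
      T₁ = e₁ (θQ *Q w)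
      T₂ = e₁ (θQ *Q (θQ *Q w))
      p∣T₀ : p ∣ T₀
      p∣T₀ = nilpotent⇒∣e₁ _ p∣w²
      p∣T₁ : p ∣ T₁
      p∣T₁ = nilpotent⇒∣e₁ _ (∣-square-* θQ p∣w²)
      p∣T₂ : p ∣ T₂
      p∣T₂ = nilpotent⇒∣e₁ _ (∣-square-* θQ (∣-square-* θQ p∣w²))
      p∣T₃ : p ∣ e₁ (θQ *Q (θQ *Q (θQ *Q w)))
      p∣T₃ = nilpotent⇒∣e₁ _ (∣-square-* θQ (∣-square-* θQ (∣-square-* θQ p∣w²)))
      -- One factor p is explicit in w² = u p. The other divides the trace of u, since u is a
      -- multiple of a member of the sequence and so its square is divisible by p.
      p²∣Tr-w² : p * p ∣ e₁ (w *Q w)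
      p²∣Tr-w² = subst (p * p ∣_) (sym (trans (cong e₁ w²≡up) (e₁-*const u p)))
        (*-monoˡ-∣ p (nilpotent⇒∣e₁ u (∣-square-* N (p∣v² (k ℕ.+ k)))))
      p²∣Δw₃² : p * p ∣ Δ * π₃ w * π₃ w
      p²∣Δw₃² = subst (p * p ∣_) (sym (trace-form w))
        (∣-combination (+ 9 * a * a) (+ 24 * a) (+ 16 * b) (+ 36 * a * a) {T₀ * T₀} {T₁ * T₂} {T₁ * T₁} {e₁ (w *Q w)}
          (∣-*-∣ p∣T₀ p∣T₀) (∣-*-∣ p∣T₁ p∣T₂) (∣-*-∣ p∣T₁ p∣T₁) p²∣Tr-w²)
      p∣w₃ : p ∣ π₃ w
      p∣w₃ = p²∤m∧p²∣mn²⇒p∣n euclid {Δ} {π₃ w} p²∤Δ p²∣Δw₃²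
      rest : p ∣ π₀ w × p ∣ π₁ w × p ∣ π₂ w
      rest = trace-relations⇒∣ euclid (+ 3 * a) b (+ 3 * a * a) (π₀ w) (π₁ w) (π₂ w) (π₃ w) p∤g p∣w₃
        (subst (p ∣_) (e₁-formula w) p∣T₀) (subst (p ∣_) (e₁-θ-formula w) p∣T₁)
        (subst (p ∣_) (e₁-θ²-formula w) p∣T₂) (subst (p ∣_) (e₁-θ³-formula w) p∣T₃)

-- Radicals, and maximality at primes dividing the gcd.

module Radicals (a b : ℤ) where
  open Order a b
  open OrderDivisibility a b
  open CommutativeRingLemmas commutativeRing
  open CommutativeRing commutativeRing using (*-commutativeSemigroup)
  open import Algebra.Properties.CommutativeSemigroup.Divisibility *-commutativeSemigroup
    using (_∣ʳ_) renaming (_,_ to infixr 4 _,ʳ_)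

  f : ℤ → ℤ
  f c = c * (c * (c * c)) + (a * c + b)

  b≡f0 : b ≡ f 0ℤ
  b≡f0 = expand a b
    where
    expand : ∀ a b → b ≡ 0ℤ * (0ℤ * (0ℤ * 0ℤ)) + (a * 0ℤ + b)
    expand = solve-∀

  -- The value at c of the polynomial representing w. When p ∣ f c it is a ring homomorphism modulo
  -- p, with kernel (p , θ - c).
  ev : ℤ → Quad ℤ → ℤ
  ev c w = π₀ w + c * (π₁ w + c * (π₂ w + c * π₃ w))

  private
    f′ : ∀ {n} → Expr ℤ (suc (suc n)) → Expr ℤ (suc (suc n))
    f′ c = c ⊗ (c ⊗ (c ⊗ c)) ⊕ (Ι (# 0) ⊗ c ⊕ Ι (# 1))
    ev′ : ∀ {n} → Expr ℤ n → Quad (Expr ℤ n) → Expr ℤ n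
    ev′ c w = π₀ w ⊕ c ⊗ (π₁ w ⊕ c ⊗ (π₂ w ⊕ c ⊗ π₃ w))
    C : Expr ℤ 7
    C = Ι (# 6)
    A B : ∀ {n} → Expr ℤ (suc (suc n))
    A = Ι (# 0)
    B = Ι (# 1)
    env : Quad ℤ → ℤ → Vec ℤ 7
    env (quad x₀ x₁ x₂ x₃) c = a ∷ b ∷ x₀ ∷ x₁ ∷ x₂ ∷ x₃ ∷ c ∷ []

  opaque
    unfolding _*Q_

    -- s₄, s₅, s₆ are the coefficients of θ⁴, θ⁵, θ⁶ in the square of w before reduction by f.
    ev-square : ∀ c w → let s₄ = + 2 * π₁ w * π₃ w + π₂ w * π₂ w ; s₅ = + 2 * π₂ w * π₃ w ; s₆ = π₃ w * π₃ w in
      ev c (w *Q w) ≡ ev c w * ev c w + - (f c * (s₄ + c * (s₅ + c * s₆)))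
    ev-square c w = solveℤ (env w c) (ev′ C (X S.*Q X))
      (ev′ C X ⊗ ev′ C X ⊕ (⊝ (f′ C ⊗ ((Κ (+ 2) ⊗ π₁ X ⊗ π₃ X ⊕ π₂ X ⊗ π₂ X) ⊕
        C ⊗ (Κ (+ 2) ⊗ π₂ X ⊗ π₃ X ⊕ C ⊗ (π₃ X ⊗ π₃ X)))))) refl

    ev-*const : ∀ c w d → ev c (w *Q const d) ≡ ev c w * d
    ev-*const c w@(quad x₀ x₁ x₂ x₃) d = solveℤ (a ∷ b ∷ x₀ ∷ x₁ ∷ x₂ ∷ x₃ ∷ c ∷ d ∷ [])
      (ev′ (Ι (# 6)) (X S.*Q S.const (Ι (# 7)))) (ev′ (Ι (# 6)) X ⊗ Ι (# 7)) refl

    linear-* : ∀ c w → quad (- c) 1ℤ 0ℤ 0ℤ *Q w ≡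
      quad (- (c * π₀ w + b * π₃ w)) (π₀ w + - (c * π₁ w + a * π₃ w)) (π₁ w + - (c * π₂ w)) (π₂ w + - (c * π₃ w))
    linear-* c w = solveQ (env w c) (quad (⊝ C) (Κ 1ℤ) (Κ 0ℤ) (Κ 0ℤ) S.*Q X)
      (quad (⊝ (C ⊗ π₀ X ⊕ B ⊗ π₃ X)) (π₀ X ⊕ (⊝ (C ⊗ π₁ X ⊕ A ⊗ π₃ X))) (π₁ X ⊕ (⊝ (C ⊗ π₂ X))) (π₂ X ⊕ (⊝ (C ⊗ π₃ X)))) refl

    -- Reduction of (x - c) w(x) subtracts w₃ f(x), and the first factor vanishes at c.
    ev-linear-* : ∀ c w → ev c (quad (- c) 1ℤ 0ℤ 0ℤ *Q w) ≡ - (f c * π₃ w)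
    ev-linear-* c w = solveℤ (env w c) (ev′ C (quad (⊝ C) (Κ 1ℤ) (Κ 0ℤ) (Κ 0ℤ) S.*Q X)) (⊝ (f′ C ⊗ π₃ X)) refl

    linear⁴ : ∀ c → let h = quad (- c) 1ℤ 0ℤ 0ℤ in h *Q (h *Q (h *Q h)) ≡
      quad (c * (c * (c * c)) + - b) (- (+ 4 * (c * (c * c)) + a)) (+ 6 * (c * c)) (- (+ 4 * c))
    linear⁴ c = solveQ (a ∷ b ∷ c ∷ []) (H S.*Q (H S.*Q (H S.*Q H)))
      (quad (c′ ⊗ (c′ ⊗ (c′ ⊗ c′)) ⊕ (⊝ B)) (⊝ (Κ (+ 4) ⊗ (c′ ⊗ (c′ ⊗ c′)) ⊕ A)) (Κ (+ 6) ⊗ (c′ ⊗ c′)) (⊝ (Κ (+ 4) ⊗ c′))) refl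
      where
      c′ : Expr ℤ 3
      c′ = Ι (# 2)
      H : Quad (Expr ℤ 3)
      H = quad (⊝ c′) (Κ 1ℤ) (Κ 0ℤ) (Κ 0ℤ)

    quadratic-* : ∀ w → quad 0ℤ a 1ℤ 0ℤ *Q w ≡
      quad (- (b * (π₂ w + a * π₃ w))) (a * π₀ w + - (a * π₂ w + (b * π₃ w + a * a * π₃ w)))
        (a * π₁ w + (π₀ w + - (a * π₃ w))) (π₁ w + a * π₂ w)
    quadratic-* w = solveQ (env₁ w) (quad (Κ 0ℤ) A (Κ 1ℤ) (Κ 0ℤ) S.*Q X)
      (quad (⊝ (B ⊗ (π₂ X ⊕ A ⊗ π₃ X))) (A ⊗ π₀ X ⊕ (⊝ (A ⊗ π₂ X ⊕ (B ⊗ π₃ X ⊕ A ⊗ A ⊗ π₃ X))))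
        (A ⊗ π₁ X ⊕ (π₀ X ⊕ (⊝ (A ⊗ π₃ X)))) (π₁ X ⊕ A ⊗ π₂ X)) refl

    -- Dividing x (x + a) w(x) by f gives the quotient w₃ x + w₂ + a w₃, whose value at -a is w₂.
    ev-quadratic-* : ∀ w → ev (- a) (quad 0ℤ a 1ℤ 0ℤ *Q w) ≡ - (f (- a) * π₂ w)
    ev-quadratic-* w = solveℤ (env₁ w) (ev′ (⊝ A) (quad (Κ 0ℤ) A (Κ 1ℤ) (Κ 0ℤ) S.*Q X)) (⊝ (f′ (⊝ A) ⊗ π₂ X)) refl

    -- The first factor is θ (θ + a)³, that is, the difference of x (x + a)³ and f at θ.
    quadratic⁴ : let h = quad 0ℤ a 1ℤ 0ℤ in h *Q (h *Q (h *Q h)) ≡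
      quad (- b) (a * (a * a) + - a) (+ 3 * (a * a)) (+ 3 * a) *Q quad (- b) (- a) 0ℤ a
    quadratic⁴ = solveQ (a ∷ b ∷ []) (H S.*Q (H S.*Q (H S.*Q H)))
      (quad (⊝ B) (A ⊗ (A ⊗ A) ⊕ (⊝ A)) (Κ (+ 3) ⊗ (A ⊗ A)) (Κ (+ 3) ⊗ A) S.*Q quad (⊝ B) (⊝ A) (Κ 0ℤ) A) refl
      where
      H : Quad (Expr ℤ 2)
      H = quad (Κ 0ℤ) A (Κ 1ℤ) (Κ 0ℤ)

  ∣Q⇒∣ev : ∀ {d w} c → d ∣Q w → d ∣ ev c w
  ∣Q⇒∣ev {d} c (q ,ʳ eq) = divides (ev c q) (trans (cong (ev c) (sym eq)) (ev-*const c q d))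

  module _ {p : ℤ} .{{_ : NonZero p}} (euclid : EuclidsLemma p) where

    ∣ev-sqrt : ∀ c {w} → p ∣ f c → p ∣ ev c (w *Q w) → p ∣ ev c w
    ∣ev-sqrt c {w} p∣fc d = [ id , id ]′ (euclid (ev c w) (ev c w)
      (∣m+n∣n⇒∣m {m = ev c w * ev c w} (subst (p ∣_) (ev-square c w) d) (∣m⇒∣-m (∣m⇒∣m*n {m = f c} _ p∣fc))))

    -- The value of t p at c has one factor p from t and one from p, so p² ∣ f(c) y. As p² ∤ f(c),
    -- some factor p falls on y.
    simple-root : ∀ c {w t h y} → ¬ p * p ∣ f c → ev c (h *Q w) ≡ - (f c * y) →
      t *Q const p ≡ h *Q w → p ∣ ev c t → p ∣ y
    simple-root c {w} {t} {h} {y} p²∤fc ev-h eq p∣t =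
      [ (λ d → contradiction d p²∤fc) , id ]′ (p²∣mn⇒p²∣m⊎p∣n euclid (f c) y (∣-unneg p²∣-fcy))
      where
      p²∣-fcy : p * p ∣ - (f c * y)
      p²∣-fcy = subst (p * p ∣_) (trans (sym (ev-*const c t p)) (trans (cong (ev c) eq) ev-h)) (*-monoˡ-∣ p p∣t)

    -- The last four hypotheses together say f ≡ (x - c)⁴ modulo p, which makes h⁴ divisible by p
    -- for h = θ - c. With p² ∤ f(c) this is Eisenstein's condition on f(x + c).
    eisenstein-maximal : ∀ c → p ∣ f c → ¬ p * p ∣ f c → p ∣ + 4 * c → p ∣ + 6 * (c * c) →
      p ∣ + 4 * (c * (c * c)) + a → p ∣ c * (c * (c * c)) + - b → MaximalAt (const p)
    eisenstein-maximal c p∣fc p²∤fc d₃ d₂ d₁ d₀ =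
      maximal-from-radical {const p} {h} (const-regular p) (λ w → p ∣ ev c w)
        (∣Q⇒∣ev c) (∣ev-sqrt c p∣fc)
        (subst (p ∣Q_) (sym (linear⁴ c)) (∣ᶜ⇒∣Q (d₀ , ∣m⇒∣-m d₁ , d₂ , ∣m⇒∣-m d₃)))
        multiplier
      where
      h = quad (- c) 1ℤ 0ℤ 0ℤ
      multiplier : ∀ {w t} → p ∣ ev c w → t *Q const p ≡ h *Q w → p ∣ ev c t → p ∣Q w
      multiplier {w} {t} _ eq p∣t = ∣ᶜ⇒∣Q (p∣w₀ , p∣w₁ , p∣w₂ , p∣w₃)
        where
        p∣hw : p ∣ᶜ quad (- (c * π₀ w + b * π₃ w)) (π₀ w + - (c * π₁ w + a * π₃ w)) (π₁ w + - (c * π₂ w)) (π₂ w + - (c * π₃ w))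
        p∣hw = subst (p ∣ᶜ_) (linear-* c w) (∣Q⇒∣ᶜ (t ,ʳ eq))
        p∣w₃ : p ∣ π₃ w
        p∣w₃ = simple-root c {w} {t} {h} p²∤fc (ev-linear-* c w) eq p∣t
        -- With w₃ settled, the coefficients of h w, read from θ³ down to θ, give w₂, w₁ and w₀ in
        -- turn.
        p∣w₂ : p ∣ π₂ w
        p∣w₂ = ∣m+n∣n⇒∣m {m = π₂ w} (proj₂ (proj₂ (proj₂ p∣hw))) (∣m⇒∣-m (∣n⇒∣m*n c p∣w₃))
        p∣w₁ : p ∣ π₁ w
        p∣w₁ = ∣m+n∣n⇒∣m {m = π₁ w} (proj₁ (proj₂ (proj₂ p∣hw))) (∣m⇒∣-m (∣n⇒∣m*n c p∣w₂))
        p∣w₀ : p ∣ π₀ w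
        p∣w₀ = ∣m+n∣n⇒∣m {m = π₀ w} (proj₁ (proj₂ p∣hw))
          (∣m⇒∣-m (∣m∣n⇒∣m+n (∣n⇒∣m*n c p∣w₁) (∣n⇒∣m*n a p∣w₃)))

    -- The case f ≡ x (x + a)³ modulo p = 3.
    cubed-factor-maximal : p ∣ + 3 → p ∣ b → ¬ p ∣ a → p ∣ a * (a * a) + - a →
      p ∣ f (- a) → ¬ p * p ∣ f (- a) → MaximalAt (const p)
    cubed-factor-maximal p∣3 p∣b p∤a p∣a³-a p∣f p²∤f =
      maximal-from-radical {const p} {h} (const-regular p) (λ w → p ∣ ev 0ℤ w × p ∣ ev (- a) w)
        (λ d → ∣Q⇒∣ev 0ℤ d , ∣Q⇒∣ev (- a) d)
        (λ (d , e) → ∣ev-sqrt 0ℤ p∣f0 d , ∣ev-sqrt (- a) p∣f e)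
        (subst (p ∣Q_) (sym quadratic⁴) (∣-*ʳ (quad (- b) (- a) 0ℤ a) (∣ᶜ⇒∣Q
          (∣m⇒∣-m p∣b , p∣a³-a , ∣m⇒∣m*n (a * a) p∣3 , ∣m⇒∣m*n a p∣3))))
        multiplier
      where
      h = quad 0ℤ a 1ℤ 0ℤ
      p∣f0 : p ∣ f 0ℤ
      p∣f0 = subst (p ∣_) b≡f0 p∣b
      multiplier : ∀ {w t} → p ∣ ev 0ℤ w × p ∣ ev (- a) w → t *Q const p ≡ h *Q w →
        p ∣ ev 0ℤ t × p ∣ ev (- a) t → p ∣Q w
      multiplier {w} {t} (p∣w0 , _) eq (_ , p∣t) = ∣ᶜ⇒∣Q (p∣w₀ , p∣w₁ , p∣w₂ , p∣w₃)
        where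
        p∣hw : p ∣ᶜ quad (- (b * (π₂ w + a * π₃ w))) (a * π₀ w + - (a * π₂ w + (b * π₃ w + a * a * π₃ w)))
          (a * π₁ w + (π₀ w + - (a * π₃ w))) (π₁ w + a * π₂ w)
        p∣hw = subst (p ∣ᶜ_) (quadratic-* w) (∣Q⇒∣ᶜ (t ,ʳ eq))
        -- At the root 0, simple modulo p, membership of w in the radical already gives w₀. At the
        -- triple root -a it is the membership of t that gives w₂. The θ-coefficient of h w then
        -- reduces to -a² w₃, and the θ²-coefficient to a w₁.
        p∣w₀ : p ∣ π₀ w
        p∣w₀ = subst (p ∣_) (ℤₚ.+-identityʳ (π₀ w)) p∣w0
        p∣w₂ : p ∣ π₂ w
        p∣w₂ = simple-root (- a) {w} {t} {h} p²∤f (ev-quadratic-* w) eq p∣t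
        p∣w₃ : p ∣ π₃ w
        p∣w₃ = ∣-cancelˡ euclid {a} p∤a (∣-cancelˡ euclid {a} {a * π₃ w} p∤a (subst (p ∣_) (ℤₚ.*-assoc a a (π₃ w))
          (∣m+n∣m⇒∣n {m = b * π₃ w} (∣m+n∣m⇒∣n {m = a * π₂ w}
            (∣-unneg (∣m+n∣m⇒∣n {m = a * π₀ w} (proj₁ (proj₂ p∣hw)) (∣n⇒∣m*n a p∣w₀)))
            (∣n⇒∣m*n a p∣w₂)) (∣m⇒∣m*n (π₃ w) p∣b))))
        p∣w₁ : p ∣ π₁ w
        p∣w₁ = ∣-cancelˡ euclid {a} p∤a (∣m+n∣n⇒∣m {m = a * π₁ w} (proj₁ (proj₂ (proj₂ p∣hw)))
          (∣m∣n⇒∣m+n p∣w₀ (∣m⇒∣-m (∣n⇒∣m*n a p∣w₃))))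

-- The congruence conditions on a and b.

∣-+-multiple : ∀ {d m} x k → d ∣ m → d ∣ x → d ∣ x + k * m
∣-+-multiple x k d∣m d∣x = ∣m∣n⇒∣m+n {m = x} d∣x (∣n⇒∣m*n k d∣m)

∤-+-multiple : ∀ {m} x k → ¬ m ∣ x → ¬ m ∣ x + k * m
∤-+-multiple x k m∤x m∣ = m∤x (∣m+n∣n⇒∣m {m = x} m∣ (∣n⇒∣m*n k ∣-refl))

value : ℤ → ℤ → ℤ
value a b = a * a * (a * a) + (- (a * a) + b)

-- value a b is f(−a); that 3 divides b and a³ − a means f ≡ x (x + a)³ modulo 3.
Admissible : ℤ → ℤ → Set
Admissible a b = + 3 ∣ b × + 3 ∣ a * (a * a) + - a × + 3 ∣ value a b × ¬ + 9 ∣ value a b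

pairs9-admissible : All (λ (r , s) → Admissible (+ r) (+ s)) pairs9
pairs9-admissible = from-yes (all? (λ (r , s) → (+ 3 ∣? + s) ×-dec (+ 3 ∣? + r * (+ r * + r) + - (+ r)) ×-dec
  (+ 3 ∣? value (+ r) (+ s)) ×-dec ¬? (+ 9 ∣? value (+ r) (+ s))) pairs9)

-- Integer polynomials in a and b respect congruence modulo 9, so the check on the twelve pairs of
-- residues extends to all a and b in these classes.
admissible-shift : ∀ r s q q′ → Admissible r s → Admissible (r + q * + 9) (s + q′ * + 9)
admissible-shift r s q q′ (3∣s , 3∣r³-r , 3∣v , 9∤v) =
  ∣-+-multiple s q′ 3∣9 3∣s ,
  subst (+ 3 ∣_) (sym (cubic r q)) (∣-+-multiple (r * (r * r) + - r) (k₃ r q) 3∣9 3∣r³-r) ,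
  subst (+ 3 ∣_) (sym (quartic r s q q′)) (∣-+-multiple (value r s) (k₄ r q q′) 3∣9 3∣v) ,
  λ d → ∤-+-multiple (value r s) (k₄ r q q′) 9∤v (subst (+ 9 ∣_) (quartic r s q q′) d)
  where
  3∣9 : + 3 ∣ + 9
  3∣9 = divides (+ 3) refl
  -- With x = r + 9q, both quotients come from x³ - r³ = 9q (x² + xr + r²), x⁴ - r⁴ = 9q (x + r)(x²
  -- + r²) and x² - r² = 9q (x + r).
  k₃ : ℤ → ℤ → ℤ
  k₃ r q = q * ((r + q * + 9) * (r + q * + 9) + (r + q * + 9) * r + r * r) + - q
  k₄ : ℤ → ℤ → ℤ → ℤ
  k₄ r q q′ = q * (r + q * + 9 + r) * ((r + q * + 9) * (r + q * + 9) + r * r) + (- (q * (r + q * + 9 + r)) + q′)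
  cubic : ∀ r q → (r + q * + 9) * ((r + q * + 9) * (r + q * + 9)) + - (r + q * + 9) ≡ r * (r * r) + - r +
    (q * ((r + q * + 9) * (r + q * + 9) + (r + q * + 9) * r + r * r) + - q) * + 9
  cubic = solve-∀
  quartic : ∀ r s q q′ →
    (r + q * + 9) * (r + q * + 9) * ((r + q * + 9) * (r + q * + 9)) + (- ((r + q * + 9) * (r + q * + 9)) + (s + q′ * + 9)) ≡
    r * r * (r * r) + (- (r * r) + s) +
    (q * (r + q * + 9 + r) * ((r + q * + 9) * (r + q * + 9) + r * r) + (- (q * (r + q * + 9 + r)) + q′)) * + 9
  quartic = solve-∀

module Conditions (a b : ℤ) where
  open Order a b
  open OrderDivisibility a b
  open Radicals a b
  open CommutativeRingLemmas commutativeRing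

  -- Since Δ = q g with q square-free, p² ∣ Δ would force p ∣ g. A prime dividing both 3a and 4b
  -- divides 27a⁴ and 256b³, hence again g.
  maximal-outside-gcd : ∀ {p} → Prime p → QuotSquareFree a b → ¬ p ℕ.∣ gAB a b → MaximalAt (const (+ p))
  maximal-outside-gcd {p} pr (q , Δ≡qg , squarefree) p∤g =
    discriminant-maximal euclid p²∤Δ λ (p∣3a , p∣4b) → p∤g (gcd-greatest
      (∣⇒∣ᵤ {+ p} {+ 256 * (b * b * b)} (subst (+ p ∣_) (256b³ b) (∣m⇒∣m*n {m = + 4 * b} (+ 64 * (b * b)) p∣4b)))
      (∣⇒∣ᵤ {+ p} {+ 27 * (a * a * a * a)} (subst (+ p ∣_) (27a⁴ a) (∣m⇒∣m*n {m = + 3 * a} (+ 9 * (a * a * a)) p∣3a))))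
    where
    instance
      _ = prime⇒nonZero pr
    euclid : EuclidsLemma (+ p)
    euclid = prime⇒euclid pr
    256b³ : ∀ b → + 4 * b * (+ 64 * (b * b)) ≡ + 256 * (b * b * b)
    256b³ = solve-∀
    27a⁴ : ∀ a → + 3 * a * (+ 9 * (a * a * a)) ≡ + 27 * (a * a * a * a)
    27a⁴ = solve-∀
    minus : ∀ x y → x + - y ≡ x ℤ.- y
    minus _ _ = refl
    Δ≡ΔAB : Δ ≡ ΔAB a b
    Δ≡ΔAB = minus (+ 256 * (b * b * b)) (+ 27 * (a * a * a * a))
    p²∤q : ¬ + p * + p ∣ q
    p²∤q p²∣q = ¬prime[1] (subst Prime (squarefree p (subst (ℕ._∣ ℤ.∣ q ∣) (ℤₚ.abs-* (+ p) (+ p)) (∣⇒∣ᵤ p²∣q))) pr)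
    p²∤Δ : ¬ + p * + p ∣ Δ
    p²∤Δ p²∣Δ = [ p²∤q , (λ p∣g → p∤g (∣⇒∣ᵤ p∣g)) ]′
      (p²∣mn⇒p²∣m⊎p∣n euclid q (+ gAB a b) (subst (+ p * + p ∣_) (trans Δ≡ΔAB Δ≡qg) p²∣Δ))

  -- Here f itself is Eisenstein at p, so c = 0.
  maximal-cond₁ : ∀ {p} → Prime p → Cond1 p a b → MaximalAt (const (+ p))
  maximal-cond₁ {p} pr (p∣a , p∣b , p²∤b) = eisenstein-maximal (prime⇒euclid pr) 0ℤ
    (subst (+ p ∣_) b≡f0 (∣ᵤ⇒∣ p∣b))
    (λ d → p²∤b (subst (ℕ._∣ ℤ.∣ b ∣) (ℤₚ.abs-* (+ p) (+ p)) (∣⇒∣ᵤ (subst (+ p * + p ∣_) (sym b≡f0) d))))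
    0∣ 0∣ (subst (+ p ∣_) (sym (ℤₚ.+-identityˡ a)) (∣ᵤ⇒∣ p∣a))
    (subst (+ p ∣_) (sym (ℤₚ.+-identityˡ (- b))) (∣m⇒∣-m (∣ᵤ⇒∣ p∣b)))
    where
    instance
      _ = prime⇒nonZero pr
    0∣ : + p ∣ 0ℤ
    0∣ = divides 0ℤ refl

  -- For a even and b odd, f ≡ (x - 1)⁴ modulo 2, hence c = 1. Whether 4 divides f(1) = 1 + a + b
  -- depends only on the residues modulo 4.
  maximal-mod-4 : ∀ {r s} → a %ℕ 4 ≡ r → b %ℕ 4 ≡ s → + 2 ∣ 1ℤ + (+ r + + s) → ¬ + 4 ∣ 1ℤ + (+ r + + s) →
    + 2 ∣ + 4 + + r → + 2 ∣ 1ℤ + - (+ s) → MaximalAt (const (+ 2))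
  maximal-mod-4 {r} {s} refl refl 2∣f 4∤f 2∣4+a 2∣1-b = eisenstein-maximal euclid 1ℤ
    (subst (+ 2 ∣_) (sym f1) (∣-+-multiple (1ℤ + (+ r + + s)) (q + q′) 2∣4 2∣f))
    (λ d → ∤-+-multiple (1ℤ + (+ r + + s)) (q + q′) 4∤f (subst (+ 4 ∣_) f1 d))
    2∣4 (divides (+ 3) refl)
    (subst (+ 2 ∣_) (trans (ℤₚ.+-assoc (+ 4) (+ r) (q * + 4)) (cong (_+_ (+ 4)) (sym a≡)))
      (∣-+-multiple (+ 4 + + r) q 2∣4 2∣4+a))
    (subst (+ 2 ∣_) (trans (one-minus (+ s) q′) (cong (λ x → 1ℤ + - x) (sym b≡)))
      (∣-+-multiple (1ℤ + - (+ s)) (- q′) 2∣4 2∣1-b))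
    where
    euclid : EuclidsLemma (+ 2)
    euclid = prime⇒euclid prime[2]
    q q′ : ℤ
    q = a /ℕ 4
    q′ = b /ℕ 4
    a≡ : a ≡ + r + q * + 4
    a≡ = a≡a%ℕn+[a/ℕn]*n a 4
    b≡ : b ≡ + s + q′ * + 4
    b≡ = a≡a%ℕn+[a/ℕn]*n b 4
    2∣4 : + 2 ∣ + 4
    2∣4 = divides (+ 2) refl
    one-minus : ∀ s q → 1ℤ + - s + - q * + 4 ≡ 1ℤ + - (s + q * + 4)
    one-minus = solve-∀
    expand : ∀ r s q q′ → 1ℤ * (1ℤ * (1ℤ * 1ℤ)) + ((r + q * + 4) * 1ℤ + (s + q′ * + 4)) ≡ 1ℤ + (r + s) + (q + q′) * + 4
    expand = solve-∀
    f1 : f 1ℤ ≡ 1ℤ + (+ r + + s) + (q + q′) * + 4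
    f1 = trans (cong₂ (λ a b → 1ℤ * (1ℤ * (1ℤ * 1ℤ)) + (a * 1ℤ + b)) a≡ b≡) (expand (+ r) (+ s) q q′)

  maximal-cond₂ : ∀ {p} → Cond2 p a b → MaximalAt (const (+ p))
  -- The numbers tested are 1 + r + s, 4 + r and 1 - s: they are 2, 4, 0 for the pair (0 , 1) and 6,
  -- 6, -2 for (2 , 3).
  maximal-cond₂ (refl , _ , inj₁ eq) = maximal-mod-4 (cong proj₁ eq) (cong proj₂ eq)
    (divides (+ 1) refl) (from-no (+ 4 ∣? + 2)) (divides (+ 2) refl) (divides 0ℤ refl)
  maximal-cond₂ (refl , _ , inj₂ eq) = maximal-mod-4 (cong proj₁ eq) (cong proj₂ eq)
    (divides (+ 3) refl) (from-no (+ 4 ∣? + 6)) (divides (+ 3) refl) (divides (- 1ℤ) refl)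

  maximal-cond₃ : ∀ {p} → Cond3 p a b → MaximalAt (const (+ p))
  maximal-cond₃ (refl , 3∤a , r,s∈pairs9) =
    cubed-factor-maximal euclid ∣-refl 3∣b (3∤a ∘ ∣⇒∣ᵤ) 3∣a³-a
      (subst (+ 3 ∣_) (value≡f a b) 3∣v) (λ d → 9∤v (subst (+ 9 ∣_) (sym (value≡f a b)) d))
    where
    euclid : EuclidsLemma (+ 3)
    euclid = prime⇒euclid (from-yes (prime? 3))
    admissible : Admissible a b
    admissible = subst₂ Admissible (sym (a≡a%ℕn+[a/ℕn]*n a 9)) (sym (a≡a%ℕn+[a/ℕn]*n b 9))
      (admissible-shift (+ (a %ℕ 9)) (+ (b %ℕ 9)) (a /ℕ 9) (b /ℕ 9) (All.lookup pairs9-admissible r,s∈pairs9))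
    3∣b = proj₁ admissible
    3∣a³-a = proj₁ (proj₂ admissible)
    3∣v = proj₁ (proj₂ (proj₂ admissible))
    9∤v = proj₂ (proj₂ (proj₂ admissible))
    value≡f : ∀ a b → a * a * (a * a) + (- (a * a) + b) ≡ - a * (- a * (- a * - a)) + (a * - a + b)
    value≡f = solve-∀

  maximal-at-primes : QuotSquareFree a b → PrimeConds a b → ∀ {p} → Prime p → MaximalAt (const (+ p))
  maximal-at-primes squarefree conds {p} pr with p ℕ.∣? gAB a b
  ... | no p∤g = maximal-outside-gcd pr squarefree p∤g
  ... | yes p∣g = [ maximal-cond₁ pr , [ maximal-cond₂ , maximal-cond₃ ]′ ]′ (conds p pr p∣g)

-- Integers inside ℚ, and clearing denominators.

toℚᵘ-ι : ∀ z → toℚᵘ (ι z) ℚᵘ.≃ mkℚᵘ z 0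
toℚᵘ-ι z = ℚₚ.toℚᵘ-fromℚᵘ (mkℚᵘ z 0)

ι-+ : ∀ m n → ι (m + n) ≡ ι m ℚ.+ ι n
ι-+ m n = ℚₚ.toℚᵘ-injective (ℚᵘₚ.≃-trans (toℚᵘ-ι (m + n)) (ℚᵘₚ.≃-trans (*≡* (eq m n)) (ℚᵘₚ.≃-sym
  (ℚᵘₚ.≃-trans (ℚₚ.toℚᵘ-homo-+ (ι m) (ι n)) (ℚᵘₚ.+-cong (toℚᵘ-ι m) (toℚᵘ-ι n))))))
  where
  eq : ∀ m n → (m + n) * 1ℤ ≡ (m * 1ℤ + n * 1ℤ) * 1ℤ
  eq = solve-∀

ι-* : ∀ m n → ι (m * n) ≡ ι m ℚ.* ι n
ι-* m n = ℚₚ.toℚᵘ-injective (ℚᵘₚ.≃-trans (toℚᵘ-ι (m * n)) (ℚᵘₚ.≃-sym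
  (ℚᵘₚ.≃-trans (ℚₚ.toℚᵘ-homo-* (ι m) (ι n)) (ℚᵘₚ.*-cong (toℚᵘ-ι m) (toℚᵘ-ι n)))))

ι-neg : ∀ m → ι (- m) ≡ ℚ.- ι m
ι-neg m = ℚₚ.toℚᵘ-injective (ℚᵘₚ.≃-trans (toℚᵘ-ι (- m)) (ℚᵘₚ.≃-sym
  (ℚᵘₚ.≃-trans (ℚₚ.toℚᵘ-homo‿- (ι m)) (ℚᵘₚ.-‿cong (toℚᵘ-ι m)))))

ι-↧* : ∀ p → ι (↧ p) ℚ.* p ≡ ι (↥ p)
ι-↧* p@record{} = ℚₚ.toℚᵘ-injective (ℚᵘₚ.≃-trans (ℚₚ.toℚᵘ-homo-* (ι (↧ p)) p)
  (ℚᵘₚ.≃-trans (ℚᵘₚ.*-congʳ {toℚᵘ p} (toℚᵘ-ι (↧ p))) (ℚᵘₚ.≃-trans (*≡* eq) (ℚᵘₚ.≃-sym (toℚᵘ-ι (↥ p))))))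
  where
  eq : (↧ p * ↥ p) * 1ℤ ≡ ↥ p * (+ (1 ℕ.* ↧ₙ p))
  eq = trans (ℤₚ.*-identityʳ (↧ p * ↥ p)) (trans (ℤₚ.*-comm (↧ p) (↥ p)) (cong (λ d → ↥ p * + d) (sym (ℕₚ.*-identityˡ (↧ₙ p)))))

clear-denominator : ∀ {n} m p → n ≡ m * ↧ p → ι n ℚ.* p ≡ ι (m * ↥ p)
clear-denominator m p refl = trans (cong (ℚ._* p) (ι-* m (↧ p))) (trans (ℚₚ.*-assoc (ι m) (ι (↧ p)) p)
  (trans (cong (ι m ℚ.*_) (ι-↧* p)) (sym (ι-* m (↥ p)))))

ι-cancel : ∀ n .{{_ : ℕ.NonZero n}} {p q} → ι (+ n) ℚ.* p ≡ ι (+ n) ℚ.* q → p ≡ q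
ι-cancel n eq = ℚₚ.≤-antisym
  (ℚₚ.*-cancelˡ-≤-pos (ι (+ n)) (ℚₚ.≤-reflexive eq)) (ℚₚ.*-cancelˡ-≤-pos (ι (+ n)) (ℚₚ.≤-reflexive (sym eq)))
  where
  instance
    _ : ℚ.Positive (ι (+ n))
    _ = ℚₚ.normalize-pos n 1

K-≡ : ∀ {x y} → c₀ x ≡ c₀ y → c₁ x ≡ c₁ y → c₂ x ≡ c₂ y → c₃ x ≡ c₃ y → x ≡ y
K-≡ refl refl refl refl = refl

embed : Quad ℤ → K
embed (quad x₀ x₁ x₂ x₃) = ⟨ ι x₀ , ι x₁ , ι x₂ , ι x₃ ⟩

ι-injective : ∀ {m n} → ι m ≡ ι n → m ≡ n
ι-injective {m} {n} eq with ℚᵘₚ.≃-trans (ℚᵘₚ.≃-sym (toℚᵘ-ι m)) (ℚᵘₚ.≃-trans (ℚₚ.toℚᵘ-cong eq) (toℚᵘ-ι n))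
... | *≡* m*1≡n*1 = ℤₚ.*-cancelʳ-≡ m n 1ℤ m*1≡n*1

embed-injective : ∀ {x y} → embed x ≡ embed y → x ≡ y
embed-injective eq = quad-≡ (ι-injective (cong c₀ eq)) (ι-injective (cong c₁ eq))
  (ι-injective (cong c₂ eq)) (ι-injective (cong c₃ eq))

clear-denominators : ∀ x → ∃ λ n → ℕ.NonZero n × ∃ λ y →
  ι (+ n) ℚ.* c₀ x ≡ ι (π₀ y) × ι (+ n) ℚ.* c₁ x ≡ ι (π₁ y) ×
  ι (+ n) ℚ.* c₂ x ≡ ι (π₂ y) × ι (+ n) ℚ.* c₃ x ≡ ι (π₃ y)
clear-denominators ⟨ p₀ , p₁ , p₂ , p₃ ⟩ = d₀ ℕ.* (d₁ ℕ.* (d₂ ℕ.* d₃)) , nonZero p₀ p₁ p₂ p₃ ,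
  quad ((D₁ * (D₂ * D₃)) * ↥ p₀) ((D₀ * (D₂ * D₃)) * ↥ p₁) ((D₀ * (D₁ * D₃)) * ↥ p₂) ((D₀ * (D₁ * D₂)) * ↥ p₃) ,
  clear-denominator (D₁ * (D₂ * D₃)) p₀ (trans n≡ (move₀ D₀ D₁ D₂ D₃)) ,
  clear-denominator (D₀ * (D₂ * D₃)) p₁ (trans n≡ (move₁ D₀ D₁ D₂ D₃)) ,
  clear-denominator (D₀ * (D₁ * D₃)) p₂ (trans n≡ (move₂ D₀ D₁ D₂ D₃)) ,
  clear-denominator (D₀ * (D₁ * D₂)) p₃ (trans n≡ (move₃ D₀ D₁ D₂ D₃))
  where
  d₀ d₁ d₂ d₃ : ℕ
  d₀ = ↧ₙ p₀
  d₁ = ↧ₙ p₁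
  d₂ = ↧ₙ p₂
  d₃ = ↧ₙ p₃
  D₀ D₁ D₂ D₃ : ℤ
  D₀ = ↧ p₀
  D₁ = ↧ p₁
  D₂ = ↧ p₂
  D₃ = ↧ p₃
  nonZero : ∀ (p q r s : ℚ) → ℕ.NonZero (↧ₙ p ℕ.* (↧ₙ q ℕ.* (↧ₙ r ℕ.* ↧ₙ s)))
  -- Matching exposes each denominator as a successor, so that the product computes to a successor.
  nonZero record{} record{} record{} record{} = _
  n≡ : + (d₀ ℕ.* (d₁ ℕ.* (d₂ ℕ.* d₃))) ≡ D₀ * (D₁ * (D₂ * D₃))
  n≡ = trans (ℤₚ.pos-* d₀ (d₁ ℕ.* (d₂ ℕ.* d₃))) (cong (D₀ *_)
    (trans (ℤₚ.pos-* d₁ (d₂ ℕ.* d₃)) (cong (D₁ *_) (ℤₚ.pos-* d₂ d₃))))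
  move₀ : ∀ w x y z → w * (x * (y * z)) ≡ x * (y * z) * w
  move₀ = solve-∀
  move₁ : ∀ w x y z → w * (x * (y * z)) ≡ w * (y * z) * x
  move₁ = solve-∀
  move₂ : ∀ w x y z → w * (x * (y * z)) ≡ w * (x * z) * y
  move₂ = solve-∀
  move₃ : ∀ w x y z → w * (x * (y * z)) ≡ w * (x * y) * z
  move₃ = solve-∀

-- Passage between K and the order.

module Conversion (a b : ℤ) where
  open Field a b
  open Order a b
  open OrderDivisibility a b
  open CommutativeRingLemmas commutativeRing
  open CommutativeRing commutativeRing using (semiring)
  open import Algebra.Properties.Semiring.Exp semiring using (_^_)

  opaque
    unfolding _+Q_ _*Q_

    const-* : ∀ m n → const m *Q const n ≡ const (m * n)
    const-* m n = trans (*Q-const (const m) n) refl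

    embed-+ : ∀ x y → embed (x +Q y) ≡ embed x +K embed y
    embed-+ x y = K-≡ (ι-+ (π₀ x) (π₀ y)) (ι-+ (π₁ x) (π₁ y)) (ι-+ (π₂ x) (π₂ y)) (ι-+ (π₃ x) (π₃ y))

    embed-* : ∀ x y → embed (x *Q y) ≡ embed x *K embed y
    embed-* x y = begin
      embed (z₀ +Q (z₁ +Q (z₂ +Q z₃)))
        ≡⟨ trans (embed-+ z₀ (z₁ +Q (z₂ +Q z₃))) (cong (embed z₀ +K_)
            (trans (embed-+ z₁ (z₂ +Q z₃)) (cong (embed z₁ +K_) (embed-+ z₂ z₃)))) ⟩
      embed z₀ +K (embed z₁ +K (embed z₂ +K embed z₃))
        ≡⟨ cong₂ _+K_ (embed-scale (π₀ x) y) (cong₂ _+K_ (embed-scale′ (π₁ x) θy≡) (cong₂ _+K_ (embed-scale′ (π₂ x) θ²y≡)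
            (embed-scale′ (π₃ x) (trans (embed-θ (mulθQ (mulθQ y))) (cong mulθ θ²y≡))))) ⟩
      embed x *K embed y ∎
      where
      open ≡-Reasoning
      open R using (scaleQ; mulθQ)
      z₀ z₁ z₂ z₃ : Quad ℤ
      z₀ = scaleQ (π₀ x) y
      z₁ = scaleQ (π₁ x) (mulθQ y)
      z₂ = scaleQ (π₂ x) (mulθQ (mulθQ y))
      z₃ = scaleQ (π₃ x) (mulθQ (mulθQ (mulθQ y)))
      embed-scale : ∀ r y → embed (scaleQ r y) ≡ scale (ι r) (embed y)
      embed-scale r y = K-≡ (ι-* r (π₀ y)) (ι-* r (π₁ y)) (ι-* r (π₂ y)) (ι-* r (π₃ y))
      embed-scale′ : ∀ r {y z} → embed y ≡ z → embed (scaleQ r y) ≡ scale (ι r) z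
      embed-scale′ r {y} eq = trans (embed-scale r y) (cong (scale (ι r)) eq)
      embed-θ : ∀ y → embed (mulθQ y) ≡ mulθ (embed y)
      embed-θ y = K-≡ (trans (ι-neg (b * π₃ y)) (cong ℚ.-_ (ι-* b (π₃ y))))
        (trans (ι-+ (π₀ y) (- (a * π₃ y))) (cong (ι (π₀ y) ℚ.+_) (trans (ι-neg (a * π₃ y)) (cong ℚ.-_ (ι-* a (π₃ y)))))) refl refl
      θy≡ : embed (mulθQ y) ≡ mulθ (embed y)
      θy≡ = embed-θ y
      θ²y≡ : embed (mulθQ (mulθQ y)) ≡ mulθ (mulθ (embed y))
      θ²y≡ = trans (embed-θ (mulθQ y)) (cong mulθ θy≡)

  embed-const : ∀ c → scale (ι c) 1K ≡ embed (const c)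
  embed-const c = K-≡ (ℚₚ.*-identityʳ (ι c)) (ℚₚ.*-zeroʳ (ι c)) (ℚₚ.*-zeroʳ (ι c)) (ℚₚ.*-zeroʳ (ι c))

  evalQ : List ℤ → Quad ℤ → Quad ℤ
  evalQ []       w = 0Q
  evalQ (c ∷ cs) w = const c +Q w *Q evalQ cs w

  embed-eval : ∀ cs w → evalK (map ι cs) (embed w) ≡ embed (evalQ cs w)
  embed-eval []       w = refl
  embed-eval (c ∷ cs) w = trans (cong₂ _+K_ (embed-const c)
      (trans (cong (embed w *K_) (embed-eval cs w)) (sym (embed-* w (evalQ cs w)))))
    (sym (embed-+ (const c) (w *Q evalQ cs w)))

  -- The monic relation is the characteristic polynomial of multiplication by w.
  embed-integral : ∀ w → IsIntegral (embed w)
  embed-integral w = e₄ w ∷ - (e₃ w) ∷ e₂ w ∷ - (e₁ w) ∷ [] ,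
    trans (embed-eval (e₄ w ∷ - (e₃ w) ∷ e₂ w ∷ - (e₁ w) ∷ 1ℤ ∷ []) w) (cong embed (trans
      (cong (λ z → const (e₄ w) +Q w *Q (const (- (e₃ w)) +Q w *Q (const (e₂ w) +Q w *Q (const (- (e₁ w)) +Q z)))) last)
      (cayley-hamilton w)))
    where
    open CommutativeRing commutativeRing using (+-identityʳ; zeroʳ; *-identityʳ)
    -- Horner evaluation ends with 1 + w · 0 for the leading coefficient, whereas `cayley-hamilton`
    -- has the bare w.
    last : w *Q (1Q +Q w *Q 0Q) ≡ w
    last = trans (cong (λ z → w *Q (1Q +Q z)) (zeroʳ w)) (trans (cong (w *Q_) (+-identityʳ 1Q)) (*-identityʳ w))

  opaque
    unfolding _+Q_ _*Q_

    evalQ-θ : ∀ w → evalQ (π₀ w ∷ π₁ w ∷ π₂ w ∷ π₃ w ∷ []) θQ ≡ w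
    evalQ-θ w = solveQ (env₁ w)
      (S.const (π₀ X) S.+Q S.θQ S.*Q (S.const (π₁ X) S.+Q S.θQ S.*Q (S.const (π₂ X) S.+Q S.θQ S.*Q
        (S.const (π₃ X) S.+Q S.θQ S.*Q S.0Q)))) X refl

  embed-InZAdj-θ : ∀ w → InZAdj θ (embed w)
  embed-InZAdj-θ w = π₀ w ∷ π₁ w ∷ π₂ w ∷ π₃ w ∷ [] ,
    trans (embed-eval (π₀ w ∷ π₁ w ∷ π₂ w ∷ π₃ w ∷ []) θQ) (cong embed (evalQ-θ w))

  InZAdj-θ⇒integral : ∀ x → InZAdj θ x → IsIntegral x
  InZAdj-θ⇒integral x (cs , eq) = subst IsIntegral (trans (sym (embed-eval cs θQ)) eq) (embed-integral (evalQ cs θQ))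

  const-^ : ∀ n k → const (+ (n ℕ.^ k)) ≡ const (+ n) ^ k
  const-^ n zero    = refl
  const-^ n (suc k) = trans (cong const (ℤₚ.pos-* n (n ℕ.^ k)))
    (trans (sym (const-* (+ n) (+ (n ℕ.^ k)))) (cong (const (+ n) *Q_) (const-^ n k)))

  scale-+ : ∀ r x y → scale r (x +K y) ≡ scale r x +K scale r y
  scale-+ r x y = K-≡ (ℚₚ.*-distribˡ-+ r (c₀ x) (c₀ y)) (ℚₚ.*-distribˡ-+ r (c₁ x) (c₁ y))
    (ℚₚ.*-distribˡ-+ r (c₂ x) (c₂ y)) (ℚₚ.*-distribˡ-+ r (c₃ x) (c₃ y))

  scale-scale : ∀ r s t x → scale (r ℚ.* s) (scale t x) ≡ scale (r ℚ.* t) (scale s x)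
  scale-scale r s t x = K-≡ (swap (c₀ x)) (swap (c₁ x)) (swap (c₂ x)) (swap (c₃ x))
    where
    open +-*-Solver
    swap : ∀ x → (r ℚ.* s) ℚ.* (t ℚ.* x) ≡ (r ℚ.* t) ℚ.* (s ℚ.* x)
    swap = solve 4 (λ r s t x → (r :* s) :* (t :* x) := (r :* t) :* (s :* x)) refl r s t

  mulθ-scale : ∀ s x → mulθ (scale s x) ≡ scale s (mulθ x)
  mulθ-scale s x = K-≡ (first (ι b) s (c₃ x)) (second (ι a) s (c₀ x) (c₃ x)) refl refl
    where
    open +-*-Solver
    first : ∀ b s x → ℚ.- (b ℚ.* (s ℚ.* x)) ≡ s ℚ.* ℚ.- (b ℚ.* x)
    first = solve 3 (λ b s x → :- (b :* (s :* x)) := s :* (:- (b :* x))) refl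
    second : ∀ a s x y → s ℚ.* x ℚ.- a ℚ.* (s ℚ.* y) ≡ s ℚ.* (x ℚ.- a ℚ.* y)
    second = solve 4 (λ a s x y → s :* x :- a :* (s :* y) := s :* (x :- a :* y)) refl

  scale-* : ∀ r s x y → scale (r ℚ.* s) (x *K y) ≡ scale r x *K scale s y
  scale-* r s x y = begin
    scale (r ℚ.* s) (z₀ +K (z₁ +K (z₂ +K z₃)))
      ≡⟨ trans (scale-+ (r ℚ.* s) z₀ (z₁ +K (z₂ +K z₃))) (cong (scale (r ℚ.* s) z₀ +K_)
          (trans (scale-+ (r ℚ.* s) z₁ (z₂ +K z₃)) (cong (scale (r ℚ.* s) z₁ +K_) (scale-+ (r ℚ.* s) z₂ z₃)))) ⟩
    scale (r ℚ.* s) z₀ +K (scale (r ℚ.* s) z₁ +K (scale (r ℚ.* s) z₂ +K scale (r ℚ.* s) z₃))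
      ≡⟨ cong₂ _+K_ (scale-scale r s (c₀ x) y) (cong₂ _+K_ (swap (c₁ x) y₁≡)
          (cong₂ _+K_ (swap (c₂ x) y₂≡) (swap (c₃ x) y₃≡))) ⟩
    scale r x *K scale s y ∎
    where
    open ≡-Reasoning
    y₁ y₂ y₃ : K
    y₁ = mulθ y
    y₂ = mulθ y₁
    y₃ = mulθ y₂
    z₀ z₁ z₂ z₃ : K
    z₀ = scale (c₀ x) y
    z₁ = scale (c₁ x) y₁
    z₂ = scale (c₂ x) y₂
    z₃ = scale (c₃ x) y₃
    y₁≡ : scale s y₁ ≡ mulθ (scale s y)
    y₁≡ = sym (mulθ-scale s y)
    y₂≡ : scale s y₂ ≡ mulθ (mulθ (scale s y))
    y₂≡ = trans (sym (mulθ-scale s y₁)) (cong mulθ y₁≡)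
    y₃≡ : scale s y₃ ≡ mulθ (mulθ (mulθ (scale s y)))
    y₃≡ = trans (sym (mulθ-scale s y₂)) (cong mulθ y₂≡)
    swap : ∀ t {y z} → scale s y ≡ z → scale (r ℚ.* s) (scale t y) ≡ scale (r ℚ.* t) z
    swap t {y} eq = trans (scale-scale r s t y) (cong (scale (r ℚ.* t)) eq)

  scale-0 : ∀ r → scale r 0K ≡ 0K
  scale-0 r = K-≡ (ℚₚ.*-zeroʳ r) (ℚₚ.*-zeroʳ r) (ℚₚ.*-zeroʳ r) (ℚₚ.*-zeroʳ r)

  *K-zeroʳ : ∀ x → x *K 0K ≡ 0K
  *K-zeroʳ x = cong₂ _+K_ (scale-0 (c₀ x)) (cong₂ _+K_ (scale-0′ (c₁ x) θ0≡0)
    (cong₂ _+K_ (scale-0′ (c₂ x) (trans (cong mulθ θ0≡0) θ0≡0))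
      (scale-0′ (c₃ x) (trans (cong (λ z → mulθ (mulθ z)) θ0≡0) (trans (cong mulθ θ0≡0) θ0≡0)))))
    where
    scale-0′ : ∀ r {z} → z ≡ 0K → scale r z ≡ 0K
    scale-0′ r refl = scale-0 r
    θ0≡0 : mulθ 0K ≡ 0K
    θ0≡0 = K-≡ (cong ℚ.-_ (ℚₚ.*-zeroʳ (ι b))) (cong (λ z → 0ℚ ℚ.- z) (ℚₚ.*-zeroʳ (ι a))) refl refl

  embed-*const : ∀ w m → embed (w *Q const m) ≡ scale (ι m) (embed w)
  embed-*const w m = trans (cong embed (*Q-const w m)) (K-≡ (swap (π₀ w)) (swap (π₁ w)) (swap (π₂ w)) (swap (π₃ w)))
    where
    swap : ∀ x → ι (x * m) ≡ ι m ℚ.* ι x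
    swap x = trans (cong ι (ℤₚ.*-comm x m)) (ι-* m x)

  -- With y = n x, `homogenise` is n^d P(x) for the monic P of degree d. This carries an equation
  -- over K to one in the order.
  embed-homogenise : ∀ {n x y} → scale (ι (+ n)) x ≡ embed y → ∀ cs →
    scale (ι (+ (n ℕ.^ length (map const cs)))) (evalK (map ι cs ++ [ 1ℚ ]) x) ≡ embed (homogenise (const (+ n)) y (map const cs))
  embed-homogenise {x = x} nx≡y [] = cong (λ z → scale 1ℚ (scale 1ℚ 1K +K z)) (*K-zeroʳ x)
  embed-homogenise {n} {x} {y} nx≡y (c ∷ cs) = begin
    scale (ι (+ (n ℕ.^ suc l))) (scale (ι c) 1K +K (x *K E))
      ≡⟨ scale-+ (ι (+ (n ℕ.^ suc l))) (scale (ι c) 1K) (x *K E) ⟩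
    scale (ι (+ (n ℕ.^ suc l))) (scale (ι c) 1K) +K scale (ι (+ (n ℕ.^ suc l))) (x *K E)
      ≡⟨ cong₂ _+K_ constant product′ ⟩
    embed (const c *Q const (+ n) ^ suc l) +K embed (y *Q H)
      ≡⟨ sym (embed-+ (const c *Q const (+ n) ^ suc l) (y *Q H)) ⟩
    embed (const c *Q const (+ n) ^ suc l +Q y *Q H) ∎
    where
    open ≡-Reasoning
    l = length (map const cs)
    E = evalK (map ι cs ++ [ 1ℚ ]) x
    H = homogenise (const (+ n)) y (map const cs)
    constant : scale (ι (+ (n ℕ.^ suc l))) (scale (ι c) 1K) ≡ embed (const c *Q const (+ n) ^ suc l)
    constant = trans (cong (scale (ι (+ (n ℕ.^ suc l)))) (embed-const c))
      (trans (sym (embed-*const (const c) (+ (n ℕ.^ suc l)))) (cong (λ u → embed (const c *Q u)) (const-^ n (suc l))))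
    product′ : scale (ι (+ (n ℕ.^ suc l))) (x *K E) ≡ embed (y *Q H)
    -- One factor n turns x into y; the remaining n ^ l clears the tail of the polynomial.
    product′ = trans (cong (λ r → scale r (x *K E)) (trans (cong ι (ℤₚ.pos-* n (n ℕ.^ l))) (ι-* (+ n) (+ (n ℕ.^ l)))))
      (trans (scale-* (ι (+ n)) (ι (+ (n ℕ.^ l))) x E)
        (trans (cong₂ _*K_ nx≡y (embed-homogenise {n} {x} {y} nx≡y cs)) (sym (embed-* y H))))

  -- Here v 1 is N x with N the product of `ps`. Removing the primes one at a time ends at N = 1,
  -- where v 1 is x itself. Repeated primes are covered because `MaximalAt` quantifies over the
  -- remaining factor N.
  descend : (∀ {p} → Prime p → MaximalAt (const (+ p))) → ∀ {ps} → All Prime ps → ∀ {v n y} →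
    SquareSequence (const (+ product ps)) v → v 1 *Q n ≡ const (+ product ps) *Q y → ∃ λ u → u *Q n ≡ y
  descend maximal [] {v} {n} {y} square v₁ = v 1 , trans v₁ (*Q-identityˡ y)
  descend maximal {p ∷ ps} (pr ∷ prs) {v} {n} {y} square v₁ =
    let (v′ , square′ , v′₁) = divide-sequence (const-regular (+ p)) (maximal pr) {N} {v} {n} {y}
          (subst (λ M → SquareSequence M v) factor square) (trans v₁ (cong (_*Q y) factor))
    in descend maximal prs {v′} {n} {y} square′ v′₁
    where
    instance
      _ = prime⇒nonZero pr
    N = const (+ product ps)
    factor : const (+ (p ℕ.* product ps)) ≡ N *Q const (+ p)
    factor = trans (cong const (trans (ℤₚ.pos-* p (product ps)) (ℤₚ.*-comm (+ p) (+ product ps))))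
      (sym (const-* (+ product ps) (+ p)))

  -- Writing x = y / n with y in the order, the homogenised equation yields the sequence N xᵏ for N
  -- = n ^ l. Descending along the prime factorisation of N shows that n divides y.
  integral⇒InZAdj-θ : (∀ {p} → Prime p → MaximalAt (const (+ p))) → ∀ x → IsIntegral x → InZAdj θ x
  integral⇒InZAdj-θ maximal x (cs , root) with clear-denominators x
  ... | n , n≢0 , y , e₀ , e₁′ , e₂′ , e₃′ = subst (InZAdj θ) embed-u≡x (embed-InZAdj-θ u)
    where
    instance
      _ : ℕ.NonZero n
      _ = n≢0
    nx≡y : scale (ι (+ n)) x ≡ embed y
    nx≡y = K-≡ e₀ e₁′ e₂′ e₃′
    l = length (map const cs)
    homogeneous-root : homogenise (const (+ n)) y (map const cs) ≡ 0Q
    homogeneous-root = embed-injective {homogenise (const (+ n)) y (map const cs)} {0Q}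
      (trans (sym (embed-homogenise {n} {x} {y} nx≡y cs)) (trans (cong (scale (ι (+ (n ℕ.^ l)))) root) (scale-0 (ι (+ (n ℕ.^ l))))))
    instance
      _ : ℕ.NonZero (n ℕ.^ l)
      _ = ℕₚ.m^n≢0 n l
    factors : PrimeFactorisation (n ℕ.^ l)
    factors = factorise (n ℕ.^ l)
    sequence = almost-integral-sequence {const (+ n)} {y} (const-regular (+ n)) (map const cs) homogeneous-root
    v = proj₁ sequence
    N≡ : const (+ n) ^ l ≡ const (+ product (PrimeFactorisation.factors factors))
    N≡ = trans (sym (const-^ n l)) (cong (λ m → const (+ m)) (PrimeFactorisation.isFactorisation factors))
    n∣y : ∃ λ u → u *Q const (+ n) ≡ y
    n∣y = descend maximal (PrimeFactorisation.factorsPrime factors) {v} {const (+ n)} {y}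
      (subst (λ N → SquareSequence N v) N≡ (proj₁ (proj₂ sequence)))
      (trans (proj₂ (proj₂ sequence)) (cong (_*Q y) N≡))
    u = proj₁ n∣y
    -- Both sides are the image of y, and n cancels in each rational coordinate.
    n·u≡n·x : scale (ι (+ n)) (embed u) ≡ scale (ι (+ n)) x
    n·u≡n·x = trans (sym (embed-*const u (+ n))) (trans (cong embed (proj₂ n∣y)) (sym nx≡y))
    embed-u≡x : embed u ≡ x
    embed-u≡x = K-≡ (ι-cancel n (cong c₀ n·u≡n·x)) (ι-cancel n (cong c₁ n·u≡n·x))
      (ι-cancel n (cong c₂ n·u≡n·x)) (ι-cancel n (cong c₃ n·u≡n·x))

theorem3p1 : (a b : ℤ) → QuotSquareFree a b → Irreducibleℚ (fPoly a b) →
    PrimeConds a b → Field.Monogenic a b × Field.RingOfIntegersIs a b (Field.θ a b)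
theorem3p1 a b squarefree _ conds = (Field.θ a b , ringOfIntegers) , ringOfIntegers
  where
  open Conversion a b
  open Conditions a b
  ringOfIntegers : Field.RingOfIntegersIs a b (Field.θ a b)
  ringOfIntegers x = mk⇔ (integral⇒InZAdj-θ (maximal-at-primes squarefree conds) x) (InZAdj-θ⇒integral x)
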